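{- There exist a constant $c>0$, a function $\delta:\mathbb{N}\to[0,\infty)$ with $\delta(n)\to 0$ as $n\to\infty$, and a deterministic distributed algorithm in the $\mathsf{LOCAL}$ model which, on every $n$-node graph $G$ with maximum degree $\Delta\ge 1$, computes in $O(\log^{c} n)$ rounds a proper edge coloring of $G$ using at most $(2\Delta-1)(1+\delta(n))$ colors.
   Context: $\mathsf{LOCAL}$ model: the network is an $n$-node simple undirected graph $G$ with one processor on each vertex; computation proceeds in synchronous rounds, and in each round each processor can send one message (of unbounded size) to each of its neighbors; local computation is free. Initially each node knows only its neighbors; nodes have distinct $O(\log n)$-bit identifiers and know the global parameters (such as $n$, $\Delta$). At the end each node outputs its part of the solution (here the colors of its incident edges). A bound of $O(f)$ rounds means $O(\max\{1,f\})$. A proper edge coloring assigns colors to the edges so that edges sharing an endpoint get different colors. -}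

module Defs where

open import Data.Fin using (Fin)
open import Data.Integer using (+_)
open import Data.List using (List; map; filter; length; allFin)
open import Data.List.Extrema.Nat using (max)
import Data.List.Sort as Sort
open import Data.Nat using (ℕ; zero; suc; _*_; _^_; _⊔_; _∸_; _≤_; _<_; _≥_)
open import Data.Nat.Logarithm using (⌈log₂_⌉)
open import Data.Nat.Properties using (≤-decTotalOrder)
open import Data.Product using (_×_; _,_; ∃-syntax)
open import Data.Rational as ℚ using (ℚ; 0ℚ; 1ℚ; _/_)
open import Function.Definitions using (Injective)
open import Level using (0ℓ)
open import Relation.Binary.Core using (Rel)
open import Relation.Binary.Definitions using (Decidable; Symmetric; Irreflexive)
import Relation.Binary.Construct.On as On
open import Relation.Binary.PropositionalEquality using (_≡_; _≢_)

record Graph (n : ℕ) : Set₁ where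
  field
    Adj     : Rel (Fin n) 0ℓ
    adj?    : Decidable Adj
    symm    : Symmetric Adj
    irrefl  : Irreflexive _≡_ Adj

  degree : Fin n → ℕ
  degree v = length (filter (adj? v) (allFin n))

  maxDegree : ℕ
  maxDegree = max 0 (map degree (allFin n))

-- b is the constant in "O(log n)-bit identifiers".  For n ≥ 2 the bound
-- 2 ^ (b * ⌈log₂ n⌉) is at least n ^ b.
record Identifiers (b n : ℕ) : Set where
  field
    ident    : Fin n → ℕ
    distinct : Injective _≡_ _≡_ ident
    short    : ∀ v → ident v < 2 ^ (b * ⌈log₂ n ⌉)

-- One program, run by every processor.  A processor refers to its neighbours
-- by their identifiers, and never sees the vertex names in Fin n.
record Algorithm : Set₁ where
  field
    State Message : Set

    -- number of nodes, maximum degree, own identifier, neighbours' identifiers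
    initial : ℕ → ℕ → ℕ → List ℕ → State

    -- the message for the neighbour with the given identifier
    send    : State → ℕ → Message

    -- one round's incoming messages, each with its sender's identifier
    receive : State → List (ℕ × Message) → State

    -- the colour of the edge to the neighbour with the given identifier
    output  : State → ℕ → ℕ

    -- Running time as a function of the number of nodes and the maximum
    -- degree.  Both are known to all processors, so all stop together.
    rounds  : ℕ → ℕ → ℕ

module Execution (A : Algorithm) {b n : ℕ} (G : Graph n) (I : Identifiers b n) where
  open Algorithm A
  open Graph G
  open Identifiers I

  -- Sorting by identifier keeps the order of the list from revealing
  -- anything about the vertex names.
  neighbours : Fin n → List (Fin n)
  neighbours v = Sort.sort (On.decTotalOrder ≤-decTotalOrder ident)
                           (filter (adj? v) (allFin n))

  stateAfter : ℕ → Fin n → State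
  stateAfter zero    v = initial n maxDegree (ident v) (map ident (neighbours v))
  stateAfter (suc t) v =
    receive (stateAfter t v)
            (map (λ u → ident u , send (stateAfter t u) (ident v)) (neighbours v))

  -- The colour that v outputs for its edge to u.
  colour : Fin n → Fin n → ℕ
  colour v u = output (stateAfter (rounds n maxDegree) v) (ident u)

-- A proper edge colouring with palette {0, …, k - 1}.  Colours are given for
-- ordered pairs; `agree` makes the two endpoints of an edge name one colour,
-- and values at non-adjacent pairs are irrelevant.
record IsProperEdgeColouring {n : ℕ} (G : Graph n) (k : ℕ)
                             (col : Fin n → Fin n → ℕ) : Set where
  open Graph G
  field
    palette : ∀ {u v} → Adj u v → col u v < k
    agree   : ∀ {u v} → Adj u v → col u v ≡ col v u
    proper  : ∀ {u v w} → Adj u v → Adj u w → v ≢ w → col u v ≢ col u w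

TendsToZero : (ℕ → ℚ) → Set
TendsToZero δ = ∀ ε → 0ℚ ℚ.< ε → ∃[ N ] (∀ n → n ≥ N → ℚ.∣ δ n ∣ ℚ.< ε)

-- The bound in O(f) is K * max {1, f}, with K independent of the graph,
-- its maximum degree and the identifiers.
ComputesColouring : (b c : ℕ) (δ : ℕ → ℚ) → Algorithm → Set₁
ComputesColouring b c δ A =
  ∃[ K ] (∀ n (G : Graph n) (I : Identifiers b n) →
    let open Graph G using (maxDegree) in
    1 ≤ maxDegree →
    Algorithm.rounds A n maxDegree ≤ K * (1 ⊔ ⌈log₂ n ⌉ ^ c) ×
    ∃[ k ] (((+ k) / 1) ℚ.≤ ((+ (2 * maxDegree ∸ 1)) / 1) ℚ.* (1ℚ ℚ.+ δ n) ×
            IsProperEdgeColouring G k (Execution.colour A G I)))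

{-# OPTIONS --safe #-}

-- No excess colours are needed (δ = 0).  Rozhoň and Ghaffari's network
-- decomposition groups at least half of the remaining nodes into clusters of
-- polylogarithmic radius such that grouped nodes at distance at most 2 share a
-- cluster.  Edges at members of different clusters are then disjoint, so the
-- centre of each cluster can colour the uncoloured edges at its members greedily:
-- an edge meets at most 2Δ - 2 others.  Logarithmically many repetitions exhaust
-- the nodes.
--
-- The clusters are formed bit by bit.  Initially each node is a cluster labelled
-- by its identifier.  In the phase of bit p, nodes whose label has bit p set
-- ask to join a near cluster whose label does not.  A cluster accepts if this
-- makes it grow by a factor 1 + 1/Q, which happens only polylogarithmically often.
-- Otherwise the applicants are deleted, at most once per cluster and phase, so
-- with Q twice the number of bits at most half of the nodes are lost.
module Submission where

open import Defs
open import Data.Bool using (Bool; true; false; T; not; if_then_else_)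
open import Data.Fin using (Fin; toℕ; fromℕ<)
import Data.Fin.Properties as Fin
import Data.Integer as ℤ
open import Data.List
  using (List; []; _∷_; _++_; length; map; mapMaybe; foldl; foldr; filter; replicate; lookup;
         allFin; downFrom; cartesianProduct)
open import Data.List.Extrema.Nat using (xs≤max)
open import Data.List.Membership.DecPropositional using () renaming (_∈?_ to member?)
open import Data.List.Membership.Propositional using (_∈_; _∉_)
open import Data.List.Membership.Propositional.Properties
  using (∈-allFin; ∈-downFrom⁺; ∈-cartesianProduct⁺; ∈-filter⁺; ∈-filter⁻; ∈-map⁺; ∈-map⁻; ∈-++⁺ˡ; ∈-++⁺ʳ)
open import Data.List.Properties
  using (++-assoc; ++-identityʳ; length-++; length-map; length-mapMaybe; length-replicate; length-tabulate; map-cong)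
open import Data.List.Relation.Binary.Permutation.Propositional using (↭-sym)
open import Data.List.Relation.Binary.Permutation.Propositional.Properties using (∈-resp-↭; ↭-length)
open import Data.List.Relation.Unary.All using (All; []; _∷_)
import Data.List.Relation.Unary.All as All
open import Data.List.Relation.Unary.AllPairs using ([]; _∷_)
open import Data.List.Relation.Unary.Any using (here; there; index)
import Data.List.Relation.Unary.Any.Properties as Any
open import Data.List.Relation.Unary.Unique.Propositional using (Unique)
import Data.List.Relation.Unary.Unique.Propositional.Properties as Unique
import Data.List.Sort as Sort
open import Data.Maybe using (Maybe; just; nothing; maybe; fromMaybe; _<∣>_; _>>=_)
open import Data.Nat
open import Data.Nat.Logarithm using (⌈log₂_⌉)
open import Data.Nat.Properties
open import Data.Nat.Solver using (module +-*-Solver)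
open import Data.Product using (_×_; _,_; proj₁; proj₂; ∃-syntax)
open import Data.Rational as ℚ using (ℚ; 0ℚ; 1ℚ)
import Data.Rational.Properties as ℚ
open import Data.Sum using (_⊎_; inj₁; inj₂)
open import Function using (_∘_; id; Injective)
open import Relation.Binary.PropositionalEquality
open import Relation.Nullary using (¬_; Dec; yes; no; contradiction; does)
open import Relation.Nullary.Decidable using (_×-dec_; _⊎-dec_)

-- Two facts make a phase work. Movement in it is one-way: only nodes whose label has bit `p` set
-- move, and only to labels in which it is clear, so a cluster with a clear bit never shrinks. And
-- all applicants of such a cluster are answered in the same step, so a later application to it can
-- only be caused by a node that has just joined it. Hence a cluster that rejects is never asked
-- again in that phase, and its population can be charged for the deleted applicants.
--
-- Distances to a centre are measured in the whole graph, so deletions and departures never spoil a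
-- radius bound. The centre of a cluster is simply the node whose identifier is the label. It goes
-- on counting, deciding and planning for that label even after it has itself been deleted or has
-- joined another cluster.

private variable
  X Y : Set

-- Finite sums over lists

∑ : List X → (X → ℕ) → ℕ
∑ []       f = 0
∑ (x ∷ xs) f = f x + ∑ xs f

∑-mono : ∀ (xs : List X) {f g} → (∀ x → f x ≤ g x) → ∑ xs f ≤ ∑ xs g
∑-mono []       f≤g = z≤n
∑-mono (x ∷ xs) f≤g = +-mono-≤ (f≤g x) (∑-mono xs f≤g)

∑-cong : ∀ (xs : List X) {f g} → (∀ x → f x ≡ g x) → ∑ xs f ≡ ∑ xs g
∑-cong []       f≡g = refl
∑-cong (x ∷ xs) f≡g = cong₂ _+_ (f≡g x) (∑-cong xs f≡g)

interchange : ∀ a b c d → (a + b) + (c + d) ≡ (a + c) + (b + d)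
interchange = solve 4 (λ a b c d → (a :+ b) :+ (c :+ d) := (a :+ c) :+ (b :+ d)) refl
  where open +-*-Solver

∑-+ : ∀ (xs : List X) f g → ∑ xs (λ x → f x + g x) ≡ ∑ xs f + ∑ xs g
∑-+ []       f g = refl
∑-+ (x ∷ xs) f g rewrite ∑-+ xs f g = interchange (f x) (g x) (∑ xs f) (∑ xs g)

∑-* : ∀ (xs : List X) c f → ∑ xs (λ x → c * f x) ≡ c * ∑ xs f
∑-* []       c f = sym (*-zeroʳ c)
∑-* (x ∷ xs) c f rewrite ∑-* xs c f = sym (*-distribˡ-+ c (f x) (∑ xs f))

∑-zero : ∀ (xs : List X) {f} → (∀ x → f x ≡ 0) → ∑ xs f ≡ 0
∑-zero []       f≡0 = refl
∑-zero (x ∷ xs) f≡0 = cong₂ _+_ (f≡0 x) (∑-zero xs f≡0)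

∑-swap : ∀ (xs : List X) (ys : List Y) (f : X → Y → ℕ) →
  ∑ xs (λ x → ∑ ys (f x)) ≡ ∑ ys (λ y → ∑ xs (λ x → f x y))
∑-swap []       ys f = sym (∑-zero ys (λ _ → refl))
∑-swap (x ∷ xs) ys f rewrite ∑-swap xs ys f = sym (∑-+ ys (f x) (λ y → ∑ xs (λ x → f x y)))

∑-≤-length : ∀ (xs : List X) {f} → (∀ x → f x ≤ 1) → ∑ xs f ≤ length xs
∑-≤-length []       f≤1 = z≤n
∑-≤-length (x ∷ xs) f≤1 = +-mono-≤ (f≤1 x) (∑-≤-length xs f≤1)

term≤∑ : ∀ {xs : List X} {x} f → x ∈ xs → f x ≤ ∑ xs f
term≤∑ f (here refl)  = m≤m+n _ _
term≤∑ f (there x∈xs) = ≤-trans (term≤∑ f x∈xs) (m≤n+m _ _)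

∑-positive : ∀ (xs : List X) {f} → 1 ≤ ∑ xs f → ∃[ x ] 1 ≤ f x
∑-positive (x ∷ xs) {f} 1≤∑ with f x in fx
... | zero  = ∑-positive xs 1≤∑
... | suc _ = x , subst (1 ≤_) (sym fx) (s≤s z≤n)

∑-single : ∀ {xs : List X} {x} {f} → Unique xs → x ∈ xs → (∀ y → y ≢ x → f y ≡ 0) → ∑ xs f ≡ f x
∑-single {xs = _ ∷ xs} {f = f} (x∉ ∷ _) (here refl) off =
  trans (cong (f _ +_) (vanish x∉)) (+-identityʳ _)
  where
  vanish : ∀ {ys} → All (_ ≢_) ys → ∑ ys f ≡ 0
  vanish []           = refl
  vanish (x≢y ∷ x≢ys) = cong₂ _+_ (off _ (x≢y ∘ sym)) (vanish x≢ys)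
∑-single {xs = y ∷ _} (y∉ ∷ unique) (there x∈xs) off =
  cong₂ _+_ (off y (λ where refl → All.lookup y∉ x∈xs refl)) (∑-single unique x∈xs off)

-- Indicators and counting by identifier

ind : Bool → ℕ
ind b = if b then 1 else 0

ind≤1 : ∀ b → ind b ≤ 1
ind≤1 false = z≤n
ind≤1 true  = ≤-refl

≡ᵇ-refl : ∀ m → (m ≡ᵇ m) ≡ true
≡ᵇ-refl zero    = refl
≡ᵇ-refl (suc m) = ≡ᵇ-refl m

≡ᵇ-true : ∀ {m n} → (m ≡ᵇ n) ≡ true → m ≡ n
≡ᵇ-true {m} {n} eq = ≡ᵇ⇒≡ m n (subst Data.Bool.T (sym eq) _)

≡ᵇ-false : ∀ {m n} → m ≢ n → (m ≡ᵇ n) ≡ false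
≡ᵇ-false {m} {n} m≢n with m ≡ᵇ n in eq
... | false = refl
... | true  = contradiction (≡ᵇ-true eq) m≢n

_is_ : Maybe ℕ → ℕ → Bool
nothing is ℓ = false
just a  is ℓ = a ≡ᵇ ℓ

is-just : ∀ {x ℓ} → (x is ℓ) ≡ true → x ≡ just ℓ
is-just {just a} eq = cong just (≡ᵇ-true eq)

just-is : ∀ {x ℓ} → x ≡ just ℓ → (x is ℓ) ≡ true
just-is {ℓ = ℓ} refl = ≡ᵇ-refl ℓ

∑-ids : ∀ {N a} → a < N → ∑ (downFrom N) (λ i → ind (a ≡ᵇ i)) ≡ 1
∑-ids {N} {a} a<N =
  trans (∑-single (Unique.downFrom⁺ N) (∈-downFrom⁺ a<N)
          (λ i i≢a → cong ind (≡ᵇ-false (i≢a ∘ sym))))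
        (cong ind (≡ᵇ-refl a))

∑-is≤1 : ∀ N x → ∑ (downFrom N) (λ i → ind (x is i)) ≤ 1
∑-is≤1 N nothing rewrite ∑-zero (downFrom N) {λ _ → 0} (λ _ → refl) = z≤n
∑-is≤1 N (just a) with a <? N
... | yes a<N = ≤-reflexive (∑-ids a<N)
... | no a≮N  = ≤-trans (≤-reflexive (zero-sum N (≮⇒≥ a≮N))) z≤n
  where
  zero-sum : ∀ M → M ≤ a → ∑ (downFrom M) (λ i → ind (a ≡ᵇ i)) ≡ 0
  zero-sum zero    _   = refl
  zero-sum (suc M) M<a = cong₂ _+_ (cong ind (≡ᵇ-false (≢-sym (<⇒≢ M<a)))) (zero-sum M (<⇒≤ M<a))

search : (ℕ → Maybe X) → ℕ → Maybe X
search g zero    = nothing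
search g (suc m) = g m <∣> search g m

search-sound : ∀ (g : ℕ → Maybe X) N {a} → search g N ≡ just a → ∃[ i ] g i ≡ just a
search-sound g (suc m) eq with g m in gm
... | just _  = m , trans gm eq
... | nothing = search-sound g m eq

search-complete : ∀ (g : ℕ → Maybe X) {N i a} → i < N → g i ≡ just a → search g N ≢ nothing
search-complete g {suc m} {i} i<N gi eq with g m in gm | i ≟ m
search-complete g {suc m} i<N gi ()   | just _  | _
search-complete g {suc m} i<N gi eq   | nothing | yes refl with () ← trans (sym gi) gm
search-complete g {suc m} i<N gi eq   | nothing | no i≢m =
  search-complete g (≤∧≢⇒< (s≤s⁻¹ i<N) i≢m) gi eq

-- Binary digits

odd : ℕ → Bool
odd zero    = false
odd (suc n) = not (odd n)

bit : ℕ → ℕ → Bool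
bit zero    n = odd n
bit (suc p) n = bit p ⌊ n /2⌋

odd-half-injective : ∀ m n → odd m ≡ odd n → ⌊ m /2⌋ ≡ ⌊ n /2⌋ → m ≡ n
odd-half-injective zero          zero          _ _ = refl
odd-half-injective zero          (suc zero)    () _
odd-half-injective (suc zero)    zero          () _
odd-half-injective (suc zero)    (suc zero)    _ _ = refl
odd-half-injective (suc (suc m)) (suc (suc n)) o h =
  cong (suc ∘ suc) (odd-half-injective m n (not² _ _ o) (suc-injective h))
  where
  not² : ∀ a b → not (not a) ≡ not (not b) → a ≡ b
  not² false false _ = refl
  not² true  true  _ = refl

⌊/2⌋-< : ∀ {m n} → m < 2 * n → ⌊ m /2⌋ < n
⌊/2⌋-< {m} {n} m<2n = *-cancelˡ-< 2 _ _ (≤-<-trans 2h≤m m<2n)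
  where
  2h≤m : 2 * ⌊ m /2⌋ ≤ m
  2h≤m = begin
    ⌊ m /2⌋ + (⌊ m /2⌋ + 0) ≡⟨ cong (⌊ m /2⌋ +_) (+-identityʳ _) ⟩
    ⌊ m /2⌋ + ⌊ m /2⌋       ≤⟨ +-monoʳ-≤ ⌊ m /2⌋ (⌊n/2⌋≤⌈n/2⌉ m) ⟩
    ⌊ m /2⌋ + ⌈ m /2⌉       ≡⟨ ⌊n/2⌋+⌈n/2⌉≡n m ⟩
    m                       ∎
    where open ≤-Reasoning

bits-injective : ∀ β {m n} → m < 2 ^ β → n < 2 ^ β → (∀ p → p < β → bit p m ≡ bit p n) → m ≡ n
bits-injective zero    (s≤s z≤n) (s≤s z≤n) _ = refl
bits-injective (suc β) {m} {n} m< n< bits =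
  odd-half-injective m n (bits 0 (s≤s z≤n))
    (bits-injective β (⌊/2⌋-< m<) (⌊/2⌋-< n<) (λ p p<β → bits (suc p) (s≤s p<β)))

abstract
  fresh : (xs : List ℕ) → ∃[ a ] (a ≤ length xs × a ∉ xs)
  fresh xs with Fin.¬∀⟶∃¬ (suc (length xs)) (λ i → toℕ i ∈ xs) (λ i → member? _≟_ (toℕ i) xs) crowded
    where
    crowded : ¬ (∀ (i : Fin (suc (length xs))) → toℕ i ∈ xs)
    crowded occurs with Fin.pigeonhole ≤-refl (index ∘ occurs)
    ... | i , j , i<j , eq = <-irrefl
      (trans (Any.lookup-index (occurs i)) (trans (cong (lookup xs) eq) (sym (Any.lookup-index (occurs j))))) i<j
  ... | i , i∉xs = toℕ i , s≤s⁻¹ (Fin.toℕ<n i) , i∉xs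

∈-mapMaybe⁺ : ∀ (f : X → Maybe Y) {xs x y} → x ∈ xs → f x ≡ just y → y ∈ mapMaybe f xs
∈-mapMaybe⁺ f {x ∷ xs} (here refl) eq rewrite eq = here refl
∈-mapMaybe⁺ f {z ∷ xs} (there x∈xs) eq with f z
... | just _  = there (∈-mapMaybe⁺ f x∈xs eq)
... | nothing = ∈-mapMaybe⁺ f x∈xs eq

length-mapMaybe-< : ∀ (f : X → Maybe Y) {xs x} → x ∈ xs → f x ≡ nothing → length (mapMaybe f xs) < length xs
length-mapMaybe-< f {x ∷ xs} (here refl) eq rewrite eq = s≤s (length-mapMaybe f xs)
length-mapMaybe-< f {z ∷ xs} (there x∈xs) eq with f z
... | just _  = s≤s (length-mapMaybe-< f x∈xs eq)
... | nothing = m<n⇒m<1+n (length-mapMaybe-< f x∈xs eq)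

-- Greedy edge colouring

module Greedy (nb : ℕ → List ℕ) where

  PartialColouring : Set
  PartialColouring = ℕ → ℕ → Maybe ℕ

  SameEdge : (i j i′ j′ : ℕ) → Set
  SameEdge i j i′ j′ = (i′ ≡ i × j′ ≡ j) ⊎ (i′ ≡ j × j′ ≡ i)

  abstract
    sameEdge? : ∀ i j i′ j′ → Dec (SameEdge i j i′ j′)
    sameEdge? i j i′ j′ = (i′ ≟ i ×-dec j′ ≟ j) ⊎-dec (i′ ≟ j ×-dec j′ ≟ i)

  used : PartialColouring → ℕ → ℕ → List ℕ
  used c i j = mapMaybe (c i) (nb i) ++ mapMaybe (c j) (nb j)

  recolour : PartialColouring → (i j a : ℕ) → PartialColouring
  recolour c i j a i′ j′ = if does (sameEdge? i j i′ j′) then just a else c i′ j′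

  -- In the intended use `nb` comes from a view: a visible node lists all its neighbours, an
  -- invisible one lists none. Testing both directions skips the edges with an invisible end.
  adjacent? : ∀ i j → Dec (j ∈ nb i × i ∈ nb j)
  adjacent? i j = member? _≟_ j (nb i) ×-dec member? _≟_ i (nb j)

  paint : PartialColouring → ℕ × ℕ → PartialColouring
  paint c (i , j) with adjacent? i j | c i j
  ... | yes _ | nothing = recolour c i j (proj₁ (fresh (used c i j)))
  ... | _     | _       = c

  greedy : ℕ → PartialColouring → PartialColouring
  greedy N c = foldl paint c (cartesianProduct (downFrom N) (downFrom N))

  record Good (k : ℕ) (c : PartialColouring) : Set where
    field
      symmetric : ∀ {i j} → j ∈ nb i → i ∈ nb j → c i j ≡ c j i
      proper    : ∀ {i j j′ a} → j ∈ nb i → j′ ∈ nb i → j ≢ j′ → c i j ≡ just a → c i j′ ≢ just a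
      bounded   : ∀ {i j a} → j ∈ nb i → c i j ≡ just a → a < k
  open Good

  module _ {Δ} (degree≤ : ∀ i → length (nb i) ≤ Δ) where

    private k = 2 * Δ ∸ 1

    module _ {c} (good : Good k c) {i j} (j∈ : j ∈ nb i) (i∈ : i ∈ nb j) (cij : c i j ≡ nothing) where

      private
        a = proj₁ (fresh (used c i j))
        c′ = recolour c i j a

      -- The uncoloured edge ij is missing from both lists, so at most
      -- 2 (Δ ∸ 1) colours are used around it.
      fresh-bounded : a < k
      fresh-bounded = begin-strict
        a                     ≤⟨ proj₁ (proj₂ (fresh (used c i j))) ⟩
        length (used c i j)   ≡⟨ length-++ (mapMaybe (c i) (nb i)) ⟩
        at i + at j           <⟨ lemma (at i) (at j) (≤-trans (length-mapMaybe-< (c i) j∈ cij) (degree≤ i))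
                                   (≤-trans (length-mapMaybe-< (c j) i∈ (trans (sym (symmetric good j∈ i∈)) cij)) (degree≤ j)) ⟩
        k ∎
        where
        open ≤-Reasoning
        at : ℕ → ℕ
        at m = length (mapMaybe (c m) (nb m))
        lemma : ∀ x y → x < Δ → y < Δ → x + y < 2 * Δ ∸ 1
        lemma x y x<Δ y<Δ = begin
          suc (x + y)               ≡⟨⟩
          suc (suc (x + y)) ∸ 1     ≡⟨ cong (_∸ 1) (cong suc (sym (+-suc x y))) ⟩
          (suc x + suc y) ∸ 1       ≤⟨ ∸-monoˡ-≤ 1 (+-mono-≤ x<Δ y<Δ) ⟩
          (Δ + Δ) ∸ 1               ≡⟨ cong (λ z → (Δ + z) ∸ 1) (sym (+-identityʳ Δ)) ⟩
          2 * Δ ∸ 1 ∎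

      fresh-free : ∀ {i′ j′ l} → SameEdge i j i′ j′ → l ∈ nb i′ → c i′ l ≢ just a
      fresh-free (inj₁ (refl , _)) l∈ eq =
        proj₂ (proj₂ (fresh (used c i j))) (∈-++⁺ˡ (∈-mapMaybe⁺ (c i) l∈ eq))
      fresh-free (inj₂ (refl , _)) l∈ eq =
        proj₂ (proj₂ (fresh (used c i j))) (∈-++⁺ʳ (mapMaybe (c i) (nb i)) (∈-mapMaybe⁺ (c j) l∈ eq))

      same-end : ∀ {i′ l m} → SameEdge i j i′ l → SameEdge i j i′ m → l ≡ m
      same-end (inj₁ (refl , refl)) (inj₁ (_ , refl))    = refl
      same-end (inj₁ (refl , refl)) (inj₂ (refl , refl)) = refl
      same-end (inj₂ (refl , refl)) (inj₁ (refl , refl)) = refl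
      same-end (inj₂ (refl , refl)) (inj₂ (_ , refl))    = refl

      recolour-good : Good k c′
      recolour-good .symmetric {i′} {j′} j′∈ i′∈ with sameEdge? i j i′ j′ | sameEdge? i j j′ i′
      ... | yes _  | yes _  = refl
      ... | no _   | no _   = symmetric good j′∈ i′∈
      ... | yes (inj₁ (refl , refl)) | no ¬e = contradiction (inj₂ (refl , refl)) ¬e
      ... | yes (inj₂ (refl , refl)) | no ¬e = contradiction (inj₁ (refl , refl)) ¬e
      ... | no ¬e | yes (inj₁ (refl , refl)) = contradiction (inj₂ (refl , refl)) ¬e
      ... | no ¬e | yes (inj₂ (refl , refl)) = contradiction (inj₁ (refl , refl)) ¬e
      recolour-good .proper {i′} {l} {m} l∈ m∈ l≢m with sameEdge? i j i′ l | sameEdge? i j i′ m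
      ... | yes e | yes e′ = λ _ _ → l≢m (same-end e e′)
      ... | yes e | no _   = λ where refl → fresh-free e m∈
      ... | no _  | yes e  = λ where eq refl → fresh-free e l∈ eq
      ... | no _  | no _   = proper good l∈ m∈ l≢m
      recolour-good .bounded {i′} {l} l∈ with sameEdge? i j i′ l
      ... | yes _ = λ where refl → fresh-bounded
      ... | no _  = bounded good l∈

    paint-good : ∀ {c} → Good k c → ∀ e → Good k (paint c e)
    paint-good {c} good (i , j) with adjacent? i j | c i j in cij
    ... | yes (j∈ , i∈) | nothing = recolour-good good j∈ i∈ cij
    ... | yes _         | just _  = good
    ... | no _          | just _  = good
    ... | no _          | nothing = good

    paint-extends : ∀ {c} → Good k c → ∀ e {i j a} → c i j ≡ just a → paint c e i j ≡ just a
    paint-extends {c} good (i′ , j′) {i} {j} cij with adjacent? i′ j′ | c i′ j′ in eq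
    ... | yes _ | just _  = cij
    ... | no _  | just _  = cij
    ... | no _  | nothing = cij
    ... | yes (j∈ , i∈) | nothing with sameEdge? i′ j′ i j
    ...   | no _ = cij
    ...   | yes (inj₁ (refl , refl)) with () ← trans (sym eq) cij
    -- The reversed pair is overwritten as well; by `symmetric` it was uncoloured too.
    ...   | yes (inj₂ (refl , refl)) with () ← trans (sym eq) (trans (symmetric good j∈ i∈) cij)

    paint-colours : ∀ c {i j} → j ∈ nb i → i ∈ nb j → paint c (i , j) i j ≢ nothing
    paint-colours c {i} {j} j∈ i∈ eq with adjacent? i j | c i j in cij
    ... | yes _ | just _  with () ← trans (sym cij) eq
    ... | no ¬e | _       = ¬e (j∈ , i∈)
    ... | yes _ | nothing with sameEdge? i j i j
    ...   | yes _ with () ← eq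
    ...   | no ¬e = ¬e (inj₁ (refl , refl))

    foldl-good : ∀ es {c} → Good k c → Good k (foldl paint c es)
    foldl-good []       good = good
    foldl-good (e ∷ es) good = foldl-good es (paint-good good e)

    foldl-extends : ∀ es {c} → Good k c → ∀ {i j a} → c i j ≡ just a → foldl paint c es i j ≡ just a
    foldl-extends []       good cij = cij
    foldl-extends (e ∷ es) good cij = foldl-extends es (paint-good good e) (paint-extends good e cij)

    foldl-colours : ∀ es {c} → Good k c → ∀ {i j} → (i , j) ∈ es → j ∈ nb i → i ∈ nb j →
                    foldl paint c es i j ≢ nothing
    foldl-colours (e ∷ es) {c} good {i} {j} (here refl) j∈ i∈ eq with paint c e i j in pij
    ... | nothing = paint-colours c j∈ i∈ pij
    ... | just _  with () ← trans (sym (foldl-extends es (paint-good good e) pij)) eq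
    foldl-colours (e ∷ es) good (there e∈) j∈ i∈ = foldl-colours es (paint-good good e) e∈ j∈ i∈

    module _ (N : ℕ) {c} (good : Good k c) where

      private edges = cartesianProduct (downFrom N) (downFrom N)

      greedy-good : Good k (greedy N c)
      greedy-good = foldl-good edges good

      greedy-extends : ∀ {i j a} → c i j ≡ just a → greedy N c i j ≡ just a
      greedy-extends = foldl-extends edges good

      greedy-colours : ∀ {i j} → i < N → j < N → j ∈ nb i → i ∈ nb j → greedy N c i j ≢ nothing
      greedy-colours i<N j<N =
        foldl-colours edges good (∈-cartesianProduct⁺ (∈-downFrom⁺ i<N) (∈-downFrom⁺ j<N))

-- Cluster growing

-- Bernoulli's inequality, multiplied through by q ^ (k + 1).
bernoulli : ∀ q k → q ^ k * (q + k) ≤ q * suc q ^ k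
bernoulli q zero    = ≤-reflexive (solve 1 (λ q → con 1 :* (q :+ con 0) := q :* con 1) refl q)
  where open +-*-Solver
bernoulli q (suc k) = begin
  q * q ^ k * (q + suc k)           ≤⟨ m≤m+n _ (q ^ k * k) ⟩
  q * q ^ k * (q + suc k) + q ^ k * k ≡⟨ solve 3 (λ q k z → q :* z :* (q :+ (con 1 :+ k)) :+ z :* k
                                          := (con 1 :+ q) :* (z :* (q :+ k))) refl q k (q ^ k) ⟩
  suc q * (q ^ k * (q + k))         ≤⟨ *-monoʳ-≤ (suc q) (bernoulli q k) ⟩
  suc q * (q * suc q ^ k)           ≡⟨ solve 3 (λ q s z → s :* (q :* z) := q :* (s :* z)) refl q (suc q) (suc q ^ k) ⟩
  q * (suc q * suc q ^ k)           ∎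
  where
  open ≤-Reasoning
  open +-*-Solver

-- The case `k = q` of Bernoulli's inequality, that is, `(1 + 1/q) ^ q ≥ 2`.
doubling : ∀ q .{{_ : NonZero q}} → 2 * q ^ q ≤ suc q ^ q
doubling q = *-cancelˡ-≤ q (begin
  q * (2 * q ^ q)   ≡⟨ solve 2 (λ q z → q :* (con 2 :* z) := z :* (q :+ q)) refl q (q ^ q) ⟩
  q ^ q * (q + q)   ≤⟨ bernoulli q q ⟩
  q * suc q ^ q     ∎)
  where
  open ≤-Reasoning
  open +-*-Solver

*-^ : ∀ a b k → (a * b) ^ k ≡ a ^ k * b ^ k
*-^ a b zero    = refl
*-^ a b (suc k) rewrite *-^ a b k =
  solve 4 (λ a b x y → a :* b :* (x :* y) := a :* x :* (b :* y)) refl a b (a ^ k) (b ^ k)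
  where open +-*-Solver

-- The hypothesis says that `s` is at least `(1 + 1/q) ^ (q * k)`. Grouping the factors `q` at a
-- time gives `k` doublings.
growth : ∀ q .{{_ : NonZero q}} k {s} → suc q ^ (q * k) ≤ q ^ (q * k) * s → 2 ^ k ≤ s
growth q k {s} grown = *-cancelˡ-≤ (q ^ (q * k)) {{m^n≢0 q (q * k)}} (begin
  q ^ (q * k) * 2 ^ k   ≡⟨ cong (_* 2 ^ k) (sym (^-*-assoc q q k)) ⟩
  (q ^ q) ^ k * 2 ^ k   ≡⟨ *-comm ((q ^ q) ^ k) (2 ^ k) ⟩
  2 ^ k * (q ^ q) ^ k   ≡⟨ sym (*-^ 2 (q ^ q) k) ⟩
  (2 * q ^ q) ^ k       ≤⟨ ^-monoˡ-≤ k (doubling q) ⟩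
  (suc q ^ q) ^ k       ≡⟨ ^-*-assoc (suc q) q k ⟩
  suc q ^ (q * k)       ≤⟨ grown ⟩
  q ^ (q * k) * s       ∎)
  where open ≤-Reasoning

Labelling : ℕ → Set
Labelling n = Fin n → Maybe ℕ

alive : Maybe ℕ → ℕ
alive = maybe (λ _ → 1) 0

alive≤1 : ∀ x → alive x ≤ 1
alive≤1 nothing  = z≤n
alive≤1 (just _) = ≤-refl

aliveCount : ∀ {n} → Labelling n → ℕ
aliveCount {n} lab = ∑ (allFin n) (λ v → alive (lab v))

population : ∀ {n} → Labelling n → ℕ → ℕ
population {n} lab ℓ = ∑ (allFin n) (λ v → ind (lab v is ℓ))

-- The combinatorics of one phase, independent of the model of computation. Later `near` becomes
-- distance at most 2, and `p` is the bit being treated.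
module Clusters {n : ℕ} (near : Fin n → Fin n → Set) (N Q p : ℕ) where

  accept : Labelling n → Labelling n → ℕ → Bool
  accept lab prop ℓ = population lab ℓ ≤ᵇ Q * population prop ℓ

  -- Red means that bit `p` of the label is set, blue that it is clear. `complete` forces a red node
  -- near a blue one to propose, and leaves the choice among the near blue clusters open.
  record Proposal (lab prop : Labelling n) : Set where
    field
      proposer : ∀ {v ℓ} → prop v ≡ just ℓ → ∃[ a ] (lab v ≡ just a × bit p a ≡ true)
      target   : ∀ {v ℓ} → prop v ≡ just ℓ → ∃[ w ] (near v w × lab w ≡ just ℓ)
      blue     : ∀ {v ℓ} → prop v ≡ just ℓ → bit p ℓ ≡ false
      small    : ∀ {v ℓ} → prop v ≡ just ℓ → ℓ < N
      complete : ∀ {v w a ℓ} → lab v ≡ just a → bit p a ≡ true →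
                 near v w → lab w ≡ just ℓ → bit p ℓ ≡ false → prop v ≢ nothing

  record Step (lab prop lab′ : Labelling n) : Set where
    field
      keep    : ∀ {v} → prop v ≡ nothing → lab′ v ≡ lab v
      resolve : ∀ {v ℓ} → prop v ≡ just ℓ → lab′ v ≡ (if accept lab prop ℓ then just ℓ else nothing)

  -- The potential that pays for deletions. A blue cluster without applicants gets none for the rest
  -- of the phase (`proposal⇒accepted`), so its population can be spent once on the applicants it
  -- rejected.
  settled : Bool → ℕ → ℕ → ℕ
  settled false zero s = s
  settled _     _    _ = 0

  settledCount : Labelling n → Labelling n → ℕ
  settledCount lab prop =
    ∑ (downFrom N) (λ ℓ → settled (bit p ℓ) (population prop ℓ) (population lab ℓ))

  -- A proposal arrives only at clusters that have accepted in every earlier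
  -- step, and the deleted nodes are charged to the settled blue clusters.
  record Progress (t A : ℕ) (lab prop : Labelling n) : Set where
    field
      grown   : ∀ {ℓ} → 1 ≤ population prop ℓ → suc Q ^ t ≤ Q ^ t * population lab ℓ
      charged : Q * A ≤ Q * aliveCount lab + settledCount lab prop

  population⁺ : ∀ (lab : Labelling n) {v ℓ} → lab v ≡ just ℓ → 1 ≤ population lab ℓ
  population⁺ lab {v} {ℓ} eq =
    subst (λ b → ind b ≤ population lab ℓ) (just-is eq) (term≤∑ (λ v → ind (lab v is ℓ)) (∈-allFin v))

  population⁻ : ∀ (lab : Labelling n) {ℓ} → 1 ≤ population lab ℓ → ∃[ v ] lab v ≡ just ℓ
  population⁻ lab {ℓ} pos with ∑-positive (allFin n) pos
  ... | v , 1≤ with lab v is ℓ in eq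
  ...   | true = v , is-just eq

  population≤n : ∀ (lab : Labelling n) ℓ → population lab ℓ ≤ length (allFin n)
  population≤n lab ℓ = ∑-≤-length (allFin n) (λ v → ind≤1 (lab v is ℓ))

  -- Clusters are disjoint, since a node carries at most one label.
  settledCount≤alive : ∀ (lab prop : Labelling n) → settledCount lab prop ≤ aliveCount lab
  settledCount≤alive lab prop = begin
    settledCount lab prop
      ≤⟨ ∑-mono (downFrom N) (λ ℓ → settled≤ (bit p ℓ) (population prop ℓ) _) ⟩
    ∑ (downFrom N) (population lab)
      ≡⟨ ∑-swap (downFrom N) (allFin n) (λ ℓ v → ind (lab v is ℓ)) ⟩
    ∑ (allFin n) (λ v → ∑ (downFrom N) (λ ℓ → ind (lab v is ℓ)))      ≤⟨ ∑-mono (allFin n) (λ v → single (lab v)) ⟩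
    aliveCount lab                                                     ∎
    where
    open ≤-Reasoning
    settled≤ : ∀ b r s → settled b r s ≤ s
    settled≤ false zero    s = ≤-refl
    settled≤ false (suc r) s = z≤n
    settled≤ true  r       s = z≤n
    single : ∀ x → ∑ (downFrom N) (λ ℓ → ind (x is ℓ)) ≤ alive x
    single nothing  = ≤-reflexive (∑-zero (downFrom N) (λ _ → refl))
    single (just a) = ∑-is≤1 N (just a)

  progress-start : ∀ {lab prop} → Proposal lab prop → Progress 0 (aliveCount lab) lab prop
  progress-start {lab} {prop} P = record
    { grown = λ {ℓ} pos → let v , eq = population⁻ prop pos ; w , _ , lw = Proposal.target P eq in
                ≤-trans (population⁺ lab lw) (≤-reflexive (sym (*-identityˡ _)))
    ; charged = m≤m+n _ _ }

  module _ {lab prop lab′ prop′} (P : Proposal lab prop) (S : Step lab prop lab′) (P′ : Proposal lab′ prop′) where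
    open Proposal
    open Step S

    -- A node `v` that is still red did not propose in the previous step, for otherwise it would
    -- have turned blue or died. So its present target `w` was not yet blue with label `ℓ`, by
    -- `complete`. Hence `w` has just been accepted by `ℓ`.
    proposal⇒accepted : ∀ {ℓ} → 1 ≤ population prop′ ℓ → 1 ≤ population prop ℓ × accept lab prop ℓ ≡ true
    proposal⇒accepted {ℓ} pos
      with v , pv′ ← population⁻ prop′ pos
      with a , lv′ , red ← proposer P′ pv′ | w , vw , lw′ ← target P′ pv′
      with prop v in pv | prop w in pw
    ... | nothing | nothing =
      contradiction pv (complete P (trans (sym (keep pv)) lv′) red vw (trans (sym (keep pw)) lw′) (blue P′ pv′))
    ... | nothing | just m with accept lab prop m in am | resolve pw
    ...   | true  | lw with refl ← trans (sym lw) lw′ = population⁺ prop pw , am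
    ...   | false | lw with () ← trans (sym lw) lw′
    proposal⇒accepted {ℓ} pos | just m | _ with accept lab prop m | resolve pv
    ...   | true  | lv with refl ← trans (sym lv) lv′ with () ← trans (sym red) (blue P pv)
    ...   | false | lv with () ← trans (sym lv) lv′

    blue-kept : ∀ {v ℓ} → bit p ℓ ≡ false → lab v ≡ just ℓ → prop v ≡ nothing
    blue-kept {v} bℓ lv with prop v in pv
    ... | nothing = refl
    ... | just m with _ , lv′ , red ← proposer P pv with refl ← trans (sym lv) lv′ with () ← trans (sym red) bℓ

    population-blue : ∀ {ℓ} → bit p ℓ ≡ false → population lab ℓ ≤ population lab′ ℓ
    population-blue {ℓ} bℓ = ∑-mono (allFin n) pointwise
      where
      pointwise : ∀ v → ind (lab v is ℓ) ≤ ind (lab′ v is ℓ)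
      pointwise v with lab v is ℓ in lv
      ... | false = z≤n
      ... | true rewrite keep (blue-kept bℓ (is-just lv)) | lv = ≤-refl

    population-accepted : ∀ {ℓ} → bit p ℓ ≡ false → accept lab prop ℓ ≡ true →
                          population lab ℓ + population prop ℓ ≤ population lab′ ℓ
    population-accepted {ℓ} bℓ acc = begin
      population lab ℓ + population prop ℓ                            ≡⟨ ∑-+ (allFin n) _ _ ⟨
      ∑ (allFin n) (λ v → ind (lab v is ℓ) + ind (prop v is ℓ))       ≤⟨ ∑-mono (allFin n) pointwise ⟩
      population lab′ ℓ                                               ∎
      where
      open ≤-Reasoning
      pointwise : ∀ v → ind (lab v is ℓ) + ind (prop v is ℓ) ≤ ind (lab′ v is ℓ)
      pointwise v with lab v is ℓ in lv
      ... | true rewrite keep (blue-kept bℓ (is-just lv)) | blue-kept bℓ (is-just {lab v} lv) | lv = ≤-refl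
      ... | false with prop v is ℓ in pv
      ...   | false = z≤n
      ...   | true rewrite resolve (is-just pv) | acc | ≡ᵇ-refl ℓ = ≤-refl

    rejected : ℕ → ℕ
    rejected ℓ = if accept lab prop ℓ then 0 else population prop ℓ

    -- A node dies only when its proposal is rejected. Exchanging the sums charges each death to the
    -- label that rejected it.
    alive-lost : aliveCount lab ≤ aliveCount lab′ + ∑ (downFrom N) rejected
    alive-lost = begin
      aliveCount lab ≤⟨ ∑-mono (allFin n) pointwise ⟩
      ∑ (allFin n) (λ v → alive (lab′ v) + ∑ (downFrom N) (λ ℓ → ind (prop v is ℓ) * reject ℓ))
        ≡⟨ ∑-+ (allFin n) _ _ ⟩
      aliveCount lab′ + ∑ (allFin n) (λ v → ∑ (downFrom N) (λ ℓ → ind (prop v is ℓ) * reject ℓ))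
        ≡⟨ cong (aliveCount lab′ +_) (∑-swap (allFin n) (downFrom N) _) ⟩
      aliveCount lab′ + ∑ (downFrom N) (λ ℓ → ∑ (allFin n) (λ v → ind (prop v is ℓ) * reject ℓ))
        ≡⟨ cong (aliveCount lab′ +_) (∑-cong (downFrom N) collect) ⟩
      aliveCount lab′ + ∑ (downFrom N) rejected ∎
      where
      open ≤-Reasoning
      reject : ℕ → ℕ
      reject ℓ = if accept lab prop ℓ then 0 else 1
      collect : ∀ ℓ → ∑ (allFin n) (λ v → ind (prop v is ℓ) * reject ℓ) ≡ rejected ℓ
      collect ℓ with accept lab prop ℓ
      ... | true  = ∑-zero (allFin n) (λ v → *-zeroʳ (ind (prop v is ℓ)))
      ... | false = ∑-cong (allFin n) (λ v → *-identityʳ _)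
      pointwise : ∀ v → alive (lab v) ≤ alive (lab′ v) + ∑ (downFrom N) (λ ℓ → ind (prop v is ℓ) * reject ℓ)
      pointwise v with prop v in pv
      ... | nothing = ≤-trans (≤-reflexive (cong alive (sym (keep pv)))) (m≤m+n _ _)
      ... | just m with accept lab prop m in am | resolve pv
      ...   | true | lv rewrite lv = ≤-trans (alive≤1 (lab v)) (m≤m+n 1 _)
      ...   | false | lv rewrite lv = ≤-trans (alive≤1 (lab v)) (≤-trans (≤-reflexive (sym at-m))
                (term≤∑ (λ ℓ → ind (m ≡ᵇ ℓ) * reject ℓ) (∈-downFrom⁺ (small P pv))))
        where
        at-m : ind (m ≡ᵇ m) * reject m ≡ 1
        at-m rewrite ≡ᵇ-refl m | am = refl

    -- The charging argument for a single label. A settled blue cluster stays settled and does not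
    -- shrink; one that rejects becomes settled and pays for its applicants; in the remaining cases
    -- the left side is 0.
    settled-grows : ∀ ℓ → settled (bit p ℓ) (population prop ℓ) (population lab ℓ) + Q * rejected ℓ
                        ≤ settled (bit p ℓ) (population prop′ ℓ) (population lab′ ℓ)
    settled-grows ℓ = cases (bit p ℓ) (population prop ℓ) _ (population prop′ ℓ) _ (accept lab prop ℓ)
      red-unproposed population-blue (proposal⇒accepted {ℓ}) rejection
      where
      red-unproposed : bit p ℓ ≡ true → population prop ℓ ≡ 0
      red-unproposed red with population prop ℓ in eq
      ... | zero  = refl
      ... | suc _ with v , pv ← population⁻ prop {ℓ} (subst (1 ≤_) (sym eq) (s≤s z≤n))
                  with () ← trans (sym red) (blue P pv)
      rejection : accept lab prop ℓ ≡ false → Q * population prop ℓ ≤ population lab ℓ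
      rejection acc with ≤-total (population lab ℓ) (Q * population prop ℓ)
      ... | inj₂ r = r
      ... | inj₁ r = contradiction (≤⇒≤ᵇ r) (subst (¬_ ∘ T) (sym acc) id)
      cases : ∀ b r s r′ s′ acc → (b ≡ true → r ≡ 0) → (b ≡ false → s ≤ s′) →
              (1 ≤ r′ → 1 ≤ r × acc ≡ true) → (acc ≡ false → Q * r ≤ s) →
              settled b r s + Q * (if acc then 0 else r) ≤ settled b r′ s′
      cases true r s r′ s′ true h₁ h₂ h₃ h₄ rewrite *-zeroʳ Q = z≤n
      cases true r s r′ s′ false h₁ h₂ h₃ h₄ rewrite h₁ refl | *-zeroʳ Q = z≤n
      cases false zero s (suc r′) s′ acc h₁ h₂ h₃ h₄ = contradiction (proj₁ (h₃ (s≤s z≤n))) λ ()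
      cases false zero s zero s′ true  h₁ h₂ h₃ h₄ rewrite *-zeroʳ Q | +-identityʳ s = h₂ refl
      cases false zero s zero s′ false h₁ h₂ h₃ h₄ rewrite *-zeroʳ Q | +-identityʳ s = h₂ refl
      cases false (suc r) s r′ s′ true  h₁ h₂ h₃ h₄ rewrite *-zeroʳ Q = z≤n
      -- The rejecting cluster: failure of the test means `Q * r ≤ s`, and the cluster is settled
      -- from now on with population `s′ ≥ s`.
      cases false (suc r) s zero s′ false h₁ h₂ h₃ h₄ = ≤-trans (h₄ refl) (h₂ refl)
      cases false (suc r) s (suc r′) s′ false h₁ h₂ h₃ h₄ = contradiction (proj₂ (h₃ (s≤s z≤n))) λ ()

    progress-step : ∀ {t A} → Progress t A lab prop → Progress (suc t) A lab′ prop′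
    progress-step {t} {A} prog .Progress.grown {ℓ} pos with proposal⇒accepted pos
    ... | pos₀ , acc = begin
      suc Q * suc Q ^ t                             ≤⟨ *-monoʳ-≤ (suc Q) (Progress.grown prog pos₀) ⟩
      suc Q * (Q ^ t * s)
        ≡⟨ solve 3 (λ q z s → (con 1 :+ q) :* (z :* s) := z :* (q :* s :+ s)) refl Q (Q ^ t) s ⟩
      Q ^ t * (Q * s + s)
        -- Acceptance means that the applicants number at least `s / Q`, so the cluster grows by a
        -- factor of at least `1 + 1/Q`.
        ≤⟨ *-monoʳ-≤ (Q ^ t) (+-monoʳ-≤ (Q * s) (≤ᵇ⇒≤ s _ (subst T (sym acc) _))) ⟩
      Q ^ t * (Q * s + Q * population prop ℓ)       ≡⟨ cong (Q ^ t *_) (sym (*-distribˡ-+ Q s _)) ⟩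
      Q ^ t * (Q * (s + population prop ℓ))         ≤⟨ *-monoʳ-≤ (Q ^ t) (*-monoʳ-≤ Q (population-accepted bℓ acc)) ⟩
      Q ^ t * (Q * population lab′ ℓ)
        ≡⟨ solve 3 (λ q z s → z :* (q :* s) := q :* z :* s) refl Q (Q ^ t) (population lab′ ℓ) ⟩
      Q * Q ^ t * population lab′ ℓ                 ∎
      where
      open ≤-Reasoning
      open +-*-Solver
      s = population lab ℓ
      bℓ : bit p ℓ ≡ false
      bℓ = blue P (proj₂ (population⁻ prop pos₀))
    progress-step {t} {A} prog .Progress.charged = begin
      Q * A                                                                ≤⟨ Progress.charged prog ⟩
      Q * aliveCount lab + settledCount lab prop                           ≤⟨ +-monoˡ-≤ _ (*-monoʳ-≤ Q alive-lost) ⟩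
      Q * (aliveCount lab′ + R) + settledCount lab prop
        ≡⟨ solve 4 (λ q a r s → q :* (a :+ r) :+ s := q :* a :+ (s :+ q :* r)) refl Q (aliveCount lab′) R (settledCount lab prop) ⟩
      Q * aliveCount lab′ + (settledCount lab prop + Q * R)
        ≡⟨ cong (λ z → Q * aliveCount lab′ + (settledCount lab prop + z)) (sym (∑-* (downFrom N) Q rejected)) ⟩
      Q * aliveCount lab′ + (settledCount lab prop + ∑ (downFrom N) (λ ℓ → Q * rejected ℓ))
        ≡⟨ cong (Q * aliveCount lab′ +_) (sym (∑-+ (downFrom N) _ _)) ⟩
      Q * aliveCount lab′ + ∑ (downFrom N) (λ ℓ → settled (bit p ℓ) (population prop ℓ) (population lab ℓ) + Q * rejected ℓ)
        ≤⟨ +-monoʳ-≤ (Q * aliveCount lab′) (∑-mono (downFrom N) settled-grows) ⟩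
      Q * aliveCount lab′ + settledCount lab′ prop′ ∎
      where
      open ≤-Reasoning
      open +-*-Solver
      R = ∑ (downFrom N) rejected

  module _ .{{_ : NonZero Q}} {k A lab prop} (P : Proposal lab prop)
           (prog : Progress (Q * k) A lab prop) (crowded : length (allFin n) < 2 ^ k) where

    -- A cluster that is still asked after `Q * k` steps has accepted in all of them, so it would
    -- have at least `2 ^ k` members, more than there are nodes.
    unproposed : ∀ v → prop v ≡ nothing
    unproposed v with prop v in pv
    ... | nothing = refl
    ... | just ℓ  = contradiction
      (≤-trans (growth Q k (Progress.grown prog (population⁺ prop pv))) (population≤n lab ℓ)) (<⇒≱ crowded)

    -- Once nobody proposes, `complete` rules out a red node near a blue one.
    bit-agrees : (∀ {v w} → near v w → near w v) → ∀ {v w a b} → near v w →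
                 lab v ≡ just a → lab w ≡ just b → bit p a ≡ bit p b
    bit-agrees near-sym {v} {w} {a} {b} vw lv lw with bit p a in pa | bit p b in pb
    ... | true  | true  = refl
    ... | false | false = refl
    ... | true  | false = contradiction (unproposed v) (Proposal.complete P lv pa vw lw pb)
    ... | false | true  = contradiction (unproposed w) (Proposal.complete P lw pb (near-sym vw) lv pa)

    alive-kept : Q * A ≤ Q * aliveCount lab + aliveCount lab
    alive-kept = ≤-trans (Progress.charged prog) (+-monoʳ-≤ (Q * aliveCount lab) (settledCount≤alive lab prop))

-- Programs in the LOCAL model

module Local (D : Set) where

  -- Views are indexed by identifiers.
  Entry View : Set
  Entry = List ℕ × D
  View  = ℕ → Maybe Entry

  Update : Set
  Update = ℕ → List ℕ → D → View → D

  -- `gather r f` collects the view of radius r + 1 and then applies f.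
  data Program : Set where
    gather : ℕ → Update → Program
    _⨾_    : Program → Program → Program
    loop   : ℕ → (ℕ → Program) → Program

  infixr 5 _⨾_

  -- One instruction per round; `nothing` only forwards views.
  compile : Program → List (Maybe Update)
  compile (gather r f)   = replicate r nothing ++ just f ∷ []
  compile (P ⨾ P′)       = compile P ++ compile P′
  compile (loop zero P)    = []
  compile (loop (suc k) P) = compile (loop k P) ++ compile (P k)

  cost : Program → ℕ
  cost P = length (compile P)

  cost-loop : ∀ k P {m} → (∀ i → cost (P i) ≤ m) → cost (loop k P) ≤ k * m
  cost-loop zero    P P≤m = z≤n
  cost-loop (suc k) P {m} P≤m = begin
    cost (loop (suc k) P)          ≡⟨ length-++ (compile (loop k P)) ⟩
    cost (loop k P) + cost (P k)   ≤⟨ +-mono-≤ (cost-loop k P P≤m) (P≤m k) ⟩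
    k * m + m                      ≡⟨ +-comm (k * m) m ⟩
    suc k * m                      ∎
    where open ≤-Reasoning

  cost-⨾ : ∀ P P′ → cost (P ⨾ P′) ≡ cost P + cost P′
  cost-⨾ P P′ = length-++ (compile P)

  cost-gather : ∀ r f → cost (gather r f) ≡ suc r
  cost-gather r f = trans (length-++ (replicate r nothing)) (trans (cong (_+ 1) (length-replicate r)) (+-comm r 1))

  singleton : ℕ → Entry → View
  singleton i e j = if i ≡ᵇ j then just e else nothing

  merge : View → List (ℕ × View) → View
  merge V messages i = foldr (λ m found → proj₂ m i <∣> found) (V i) messages

  weigh : (D → Bool) → Maybe Entry → ℕ
  weigh q = maybe (λ e → ind (q (proj₂ e))) 0

  census : ℕ → (D → Bool) → View → ℕ
  census N q V = ∑ (downFrom N) (λ i → weigh q (V i))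

  record State : Set where
    constructor state
    field
      self  : ℕ
      nbrs  : List ℕ
      datum : D
      view  : View
      todo  : List (Maybe Update)
  open State

  -- After an update the view restarts from the node's own new entry, because the data collected
  -- from other nodes are out of date.
  receive : State → List (ℕ × View) → State
  receive (state i ns d V [])             ms = state i ns d V []
  receive (state i ns d V (nothing ∷ fs)) ms = state i ns d (merge V ms) fs
  receive (state i ns d V (just f ∷ fs))  ms =
    let d′ = f i ns d (merge V ms) in state i ns d′ (singleton i (ns , d′)) fs

  algorithm : D → (ℕ → ℕ → Program) → (D → ℕ → ℕ) → Algorithm
  algorithm d P out = record
    { State   = State
    ; Message = View
    ; initial = λ n Δ i ns → state i ns d (singleton i (ns , d)) (compile (P n Δ))
    ; send    = λ s _ → view s
    ; receive = receive
    ; output  = out ∘ datum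
    ; rounds  = λ n Δ → cost (P n Δ)
    }

  -- Denotational semantics: views as balls in the graph

  module Semantics {n : ℕ} (ident : Fin n → ℕ) (nbr : Fin n → List (Fin n)) where

    Config : Set
    Config = Fin n → D

    ids : Fin n → List ℕ
    ids v = map ident (nbr v)

    entry : Config → Fin n → Entry
    entry x v = ids v , x v

    ball : ℕ → Config → Fin n → View
    ball zero    x v = singleton (ident v) (entry x v)
    ball (suc k) x v = merge (ball k x v) (map (λ u → ident u , ball k x u) (nbr v))

    apply : Update → ℕ → Config → Config
    apply f k x v = f (ident v) (ids v) (x v) (ball k x v)

    ⟦_⟧ : Program → Config → Config
    ⟦ gather r f ⟧       x = apply f (suc r) x
    ⟦ P ⨾ P′ ⟧           x = ⟦ P′ ⟧ (⟦ P ⟧ x)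
    ⟦ loop zero P ⟧      x = x
    ⟦ loop (suc k) P ⟧   x = ⟦ P k ⟧ (⟦ loop k P ⟧ x)

    data Reach : ℕ → Fin n → Fin n → Set where
      stay : ∀ {k v} → Reach k v v
      hop  : ∀ {k u v w} → v ∈ nbr u → Reach k v w → Reach (suc k) u w

    reach-≤ : ∀ {j k u v} → j ≤ k → Reach j u v → Reach k u v
    reach-≤ j≤k       stay      = stay
    reach-≤ (s≤s j≤k) (hop e r) = hop e (reach-≤ j≤k r)

    reach-trans : ∀ {j k u v w} → Reach j u v → Reach k v w → Reach (j + k) u w
    reach-trans {j} {k} stay r = reach-≤ (m≤n+m k j) r
    reach-trans (hop e r) r′   = hop e (reach-trans r r′)

    module _ (nbr-sym : ∀ {u v} → u ∈ nbr v → v ∈ nbr u) where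
      reach-sym : ∀ {k u v} → Reach k u v → Reach k v u
      reach-sym stay = stay
      reach-sym {suc k} (hop e r) =
        reach-≤ (≤-reflexive (+-comm k 1)) (reach-trans (reach-sym r) (hop (nbr-sym e) (stay {0})))

    <∣>-just : ∀ {X : Set} (a b : Maybe X) {x} → a <∣> b ≡ just x → (a ≡ just x) ⊎ (b ≡ just x)
    <∣>-just (just _) b eq = inj₁ eq
    <∣>-just nothing  b eq = inj₂ eq

    <∣>-nothing : ∀ {X : Set} (a b : Maybe X) → a <∣> b ≡ nothing → a ≡ nothing × b ≡ nothing
    <∣>-nothing nothing b eq = refl , eq

    merge-just : ∀ V ms i {e} → merge V ms i ≡ just e → (V i ≡ just e) ⊎ (∃[ m ] (m ∈ ms × proj₂ m i ≡ just e))
    merge-just V []       i eq = inj₁ eq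
    merge-just V (m ∷ ms) i eq with <∣>-just (proj₂ m i) _ eq
    ... | inj₁ here-m = inj₂ (m , here refl , here-m)
    ... | inj₂ rest with merge-just V ms i rest
    ...   | inj₁ own = inj₁ own
    ...   | inj₂ (m′ , m′∈ , eq′) = inj₂ (m′ , there m′∈ , eq′)

    merge-nothing : ∀ V ms i → merge V ms i ≡ nothing → V i ≡ nothing × (∀ {m} → m ∈ ms → proj₂ m i ≡ nothing)
    merge-nothing V []       i eq = eq , λ ()
    merge-nothing V (m ∷ ms) i eq with <∣>-nothing (proj₂ m i) _ eq
    ... | m-none , rest with merge-nothing V ms i rest
    ...   | own , others = own , λ where
      (here refl) → m-none
      (there m∈)  → others m∈

    ball-sound : ∀ k x {v i e} → ball k x v i ≡ just e → ∃[ u ] (Reach k v u × ident u ≡ i × e ≡ entry x u)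
    ball-sound zero x {v} {i} eq with ident v ≡ᵇ i in vi
    ball-sound zero x {v} {i} refl | true = v , stay , ≡ᵇ-true vi , refl
    ball-sound (suc k) x {v} {i} eq with merge-just (ball k x v) _ i eq
    ... | inj₁ own with u , r , rest ← ball-sound k x own = u , reach-≤ (n≤1+n k) r , rest
    ... | inj₂ (m , m∈ , eq′) with w , w∈ , refl ← ∈-map⁻ (λ u → ident u , ball k x u) m∈
      with u , r , rest ← ball-sound k x eq′ = u , hop w∈ r , rest

    ball-present : ∀ k x {v u} → Reach k v u → ball k x v (ident u) ≢ nothing
    ball-present zero x {v} stay eq rewrite ≡ᵇ-refl (ident v) with () ← eq
    ball-present (suc k) x {v} {u} r eq with merge-nothing (ball k x v) (map (λ w → ident w , ball k x w) (nbr v)) (ident u) eq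
    ball-present (suc k) x stay      eq | own , others = ball-present k x stay own
    ball-present (suc k) x (hop e r) eq | own , others = ball-present k x r (others (∈-map⁺ (λ w → ident w , ball k x w) e))

    module _ (ident-injective : Injective _≡_ _≡_ ident) where

      -- `merge` keeps the first entry it finds, so the induction (`ball-present`) tracks only that
      -- some entry is there. Soundness and distinct identifiers then determine which one.
      ball-complete : ∀ k x {v u} → Reach k v u → ball k x v (ident u) ≡ just (entry x u)
      ball-complete k x {v} {u} r with ball k x v (ident u) in eq
      ... | nothing = contradiction eq (ball-present k x r)
      ... | just e with w , _ , iw , refl ← ball-sound k x eq with refl ← ident-injective iw = refl

      -- Double counting over identifiers and nodes: an identifier has at most one owner, and every
      -- node satisfying `q` lies inside the view.
      census-ball : ∀ {N} (ident< : ∀ v → ident v < N) k x {c} q →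
        (∀ v → q (x v) ≡ true → Reach k c v) →
        census N q (ball k x c) ≡ ∑ (allFin n) (λ v → ind (q (x v)))
      census-ball {N} ident< k x {c} q visible = begin
        ∑ (downFrom N) (λ i → weigh q (ball k x c i))
          ≡⟨ ∑-cong (downFrom N) spread ⟩
        ∑ (downFrom N) (λ i → ∑ (allFin n) (λ v → ind (q (x v)) * ind (ident v ≡ᵇ i)))
          ≡⟨ ∑-swap (downFrom N) (allFin n) _ ⟩
        ∑ (allFin n) (λ v → ∑ (downFrom N) (λ i → ind (q (x v)) * ind (ident v ≡ᵇ i)))
          ≡⟨ ∑-cong (allFin n) (λ v → trans (∑-* (downFrom N) (ind (q (x v))) (λ i → ind (ident v ≡ᵇ i)))
               (trans (cong (ind (q (x v)) *_) (∑-ids (ident< v))) (*-identityʳ _))) ⟩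
        ∑ (allFin n) (λ v → ind (q (x v))) ∎
        where
        open ≡-Reasoning
        spread : ∀ i → weigh q (ball k x c i) ≡ ∑ (allFin n) (λ v → ind (q (x v)) * ind (ident v ≡ᵇ i))
        spread i with ball k x c i in eq
        ... | just e with u , _ , refl , refl ← ball-sound k x eq = sym (trans
          (∑-single (Unique.allFin⁺ n) (∈-allFin u) (λ v v≢u →
            trans (cong (λ b → ind (q (x v)) * ind b) (≡ᵇ-false (v≢u ∘ ident-injective))) (*-zeroʳ (ind (q (x v))))))
          (trans (cong (λ b → ind (q (x u)) * ind b) (≡ᵇ-refl (ident u))) (*-identityʳ _)))
        ... | nothing = sym (∑-zero (allFin n) absent)
          where
          absent : ∀ v → ind (q (x v)) * ind (ident v ≡ᵇ i) ≡ 0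
          absent v with q (x v) in qv | ident v ≡ᵇ i in vi
          ... | false | _     = refl
          ... | true  | false = refl
          ... | true  | true with refl ← ≡ᵇ-true {ident v} vi = contradiction eq (ball-present k x (visible v qv))

  -- Round-by-round execution agrees with the semantics

  module Simulation (d : D) (P : ℕ → ℕ → Program) (out : D → ℕ → ℕ)
                    {b n : ℕ} (G : Graph n) (I : Identifiers b n) where

    open Graph G using (maxDegree)
    open Identifiers I
    open Execution (algorithm d P out) G I
    open Semantics ident neighbours

    packed : ℕ → Config → List (Maybe Update) → Fin n → State
    packed k x fs v = state (ident v) (ids v) (x v) (ball k x v) fs

    incoming : ∀ {t k x fs} → (∀ v → stateAfter t v ≡ packed k x fs v) → ∀ v →
      map (λ u → ident u , view (stateAfter t u)) (neighbours v) ≡ map (λ u → ident u , ball k x u) (neighbours v)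
    incoming eq v = map-cong (λ u → cong (λ s → ident u , view s) (eq u)) (neighbours v)

    -- Starting from a view of arbitrary radius `k` makes the induction on `r` go through: a
    -- forwarding round turns `k` into `suc k`.
    run-gather : ∀ r f {t k x fs} → (∀ v → stateAfter t v ≡ packed k x (compile (gather r f) ++ fs) v) →
      ∀ v → stateAfter (suc r + t) v ≡ packed 0 (apply f (suc r + k) x) fs v
    run-gather zero f {t} {k} {x} {fs} eq v =
      cong₂ receive (eq v) (incoming {t} {k} {x} {just f ∷ fs} eq v)
    run-gather (suc r) f {t} {k} {x} {fs} eq v =
      subst₂ (λ t′ k′ → stateAfter t′ v ≡ packed 0 (apply f k′ x) fs v) (+-suc (suc r) t) (+-suc (suc r) k)
        (run-gather r f {suc t} {suc k} {x} {fs}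
          (λ u → cong₂ receive (eq u) (incoming {t} {k} {x} {compile (gather (suc r) f) ++ fs} eq u)) v)

    append : ∀ (as bs : List (Maybe Update)) {fs t x y} →
      (∀ {fs t} → (∀ v → stateAfter t v ≡ packed 0 x (as ++ fs) v) →
                   ∀ v → stateAfter (length as + t) v ≡ packed 0 y fs v) →
      (∀ v → stateAfter t v ≡ packed 0 x ((as ++ bs) ++ fs) v) →
      ∀ v → stateAfter (length as + t) v ≡ packed 0 y (bs ++ fs) v
    append as bs {fs} {x = x} run-as eq =
      run-as (λ u → trans (eq u) (cong (λ gs → packed 0 x gs u) (++-assoc as bs fs)))

    rounds-++ : ∀ (as bs : List (Maybe Update)) t → length bs + (length as + t) ≡ length (as ++ bs) + t
    rounds-++ as bs t = begin
      length bs + (length as + t)   ≡⟨ sym (+-assoc (length bs) _ t) ⟩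
      length bs + length as + t     ≡⟨ cong (_+ t) (+-comm (length bs) (length as)) ⟩
      length as + length bs + t     ≡⟨ cong (_+ t) (sym (length-++ as)) ⟩
      length (as ++ bs) + t         ∎
      where open ≡-Reasoning

    -- The remaining instructions `fs` are arbitrary, so that the first half of a sequence can be
    -- run with the second half still pending.
    run : ∀ Q {t x fs} → (∀ v → stateAfter t v ≡ packed 0 x (compile Q ++ fs) v) →
      ∀ v → stateAfter (cost Q + t) v ≡ packed 0 (⟦ Q ⟧ x) fs v
    run (gather r f) {t} {x} {fs} eq v =
      subst (λ m → stateAfter (m + t) v ≡ packed 0 (apply f (suc r) x) fs v) (sym (cost-gather r f))
        (subst (λ k → stateAfter (suc r + t) v ≡ packed 0 (apply f (suc k) x) fs v) (+-identityʳ r)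
          (run-gather r f eq v))
    run (Q ⨾ Q′) {t} {x} {fs} eq v =
      subst (λ m → stateAfter m v ≡ packed 0 (⟦ Q ⨾ Q′ ⟧ x) fs v) (rounds-++ (compile Q) (compile Q′) t)
        (run Q′ (append (compile Q) (compile Q′) (run Q) eq) v)
    run (loop zero Q)    eq = eq
    run (loop (suc k) Q) {t} {x} {fs} eq v =
      subst (λ m → stateAfter m v ≡ packed 0 (⟦ loop (suc k) Q ⟧ x) fs v)
        (rounds-++ (compile (loop k Q)) (compile (Q k)) t)
        (run (Q k) (append (compile (loop k Q)) (compile (Q k)) (run (loop k Q)) eq) v)

    colour-run : ∀ v u → colour v u ≡ out (⟦ P n maxDegree ⟧ (λ _ → d) v) (ident u)
    colour-run v u = cong (λ s → out (datum s) (ident u)) (trans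
      (cong (λ m → stateAfter m v) (sym (+-identityʳ (cost (P n maxDegree)))))
      (run (P n maxDegree) {0} {λ _ → d} {[]}
        (λ w → cong (λ fs → packed 0 (λ _ → d) fs w) (sym (++-identityʳ _))) v))

-- Network decomposition and colouring by cluster centres

-- `live`: some incident edge may still be uncoloured.  `lab`: the identifier of
-- the centre of the node's cluster.  `acc` and `plan` are published by the
-- centre of a cluster for its members and their neighbours.
record Node : Set where
  field
    live : Bool
    lab  : Maybe ℕ
    prop : Maybe ℕ
    acc  : Bool
    plan : ℕ → ℕ → Maybe ℕ
    col  : ℕ → Maybe ℕ
open Node

open Local Node

initialNode : Node
initialNode = record
  { live = true ; lab = nothing ; prop = nothing ; acc = false
  ; plan = λ _ _ → nothing ; col = λ _ → nothing }

red? : ℕ → Maybe ℕ → Bool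
red? p = maybe (bit p) false

blueLabel : ℕ → Maybe ℕ → Maybe ℕ
blueLabel p nothing  = nothing
blueLabel p (just ℓ) = if bit p ℓ then nothing else just ℓ

joined : Maybe ℕ → Maybe ℕ → View → Maybe ℕ
joined nothing  l V = l
joined (just ℓ) l V = if maybe (acc ∘ proj₂) false (V ℓ) then just ℓ else nothing

visibleNbrs : View → ℕ → List ℕ
visibleNbrs V i = maybe proj₁ [] (V i)

visibleCol : View → ℕ → ℕ → Maybe ℕ
visibleCol V i j = maybe (λ e → col (proj₂ e) j) nothing (V i)

adopted : Maybe ℕ → Maybe ℕ → ℕ → ℕ → View → Maybe ℕ
adopted nothing  c i j V = c
adopted (just ℓ) c i j V = maybe (λ e → plan (proj₂ e) i j) nothing (V ℓ)

-- An edge is owned by the cluster of whichever endpoint is labelled. If both are, their labels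
-- coincide, so both ends compute the same owner.
owner : Maybe ℕ → ℕ → View → Maybe ℕ
owner l j V = l <∣> (V j >>= lab ∘ proj₂)

module Parameters (β : ℕ) where

  -- A cluster accepting for Q steps doubles, and 2 ^ (β + β) exceeds n.  The
  -- radius of a cluster grows by 2 in each of the β * T′ steps of an epoch.
  N Q T′ R : ℕ
  N = 2 ^ β
  Q = β + β
  T′ = Q * (β + β)
  R = 1 + β * (T′ * 2)

  propose : ℕ → Update
  propose p _ _ d V = record d
    { prop = if red? p (lab d) then search (λ i → V i >>= blueLabel p ∘ lab ∘ proj₂) N else nothing }

  -- Every node acts as a potential centre for the label equal to its identifier. `design` extends
  -- the colouring over its whole view, but `adopt` consults a plan only on the edges that its
  -- cluster owns. There it may overwrite: plans preserve the colours already given.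
  decide join design adopt reset : Update
  decide i _ d V = record d
    { acc = census N (λ d′ → lab d′ is i) V ≤ᵇ Q * census N (λ d′ → prop d′ is i) V }
  join _ _ d V = record d { lab = joined (prop d) (lab d) V }
  design _ _ d V = record d { plan = Greedy.greedy (visibleNbrs V) N (visibleCol V) }
  adopt i _ d V = record d
    { col  = λ j → adopted (owner (lab d) j V) (col d j) i j V
    ; live = maybe (λ _ → false) (live d) (lab d) }
  reset i _ d _ = record d { lab = if live d then just i else nothing }

  step : ℕ → Program
  step p = gather 1 (propose p) ⨾ gather R decide ⨾ gather R join

  phases : Program
  phases = loop β (λ p → loop T′ (λ _ → step p))

  epoch : Program
  epoch = gather 0 reset ⨾ phases ⨾ gather R design ⨾ gather R adopt

  abstract
    program : Program
    program = loop (β + β) (λ _ → epoch)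

    program≡ : program ≡ loop (β + β) (λ _ → epoch)
    program≡ = refl

  module Analysis {n : ℕ} (ident : Fin n → ℕ) (nbr : Fin n → List (Fin n))
                  (ident-injective : Injective _≡_ _≡_ ident) (ident< : ∀ v → ident v < N)
                  (nbr-sym : ∀ {u v} → u ∈ nbr v → v ∈ nbr u) where

    open Semantics ident nbr

    near : Fin n → Fin n → Set
    near = Reach 2

    near-sym : ∀ {v w} → near v w → near w v
    near-sym = reach-sym nbr-sym

    labels props : Config → Fin n → Maybe ℕ
    labels x v = lab (x v)
    props  x v = prop (x v)

    -- `x₀` is the configuration at the start of the epoch. `centred` does not ask the centre to
    -- carry the label `ℓ` itself, and its path may leave the cluster. `separated` after `p` phases
    -- concerns the bits treated so far.
    record Clustering (x₀ : Config) (p d : ℕ) (x : Config) : Set where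
      field
        centred   : ∀ {v ℓ} → lab (x v) ≡ just ℓ → ∃[ c ] (ident c ≡ ℓ × Reach d v c)
        separated : ∀ {v w a b} → near v w → lab (x v) ≡ just a → lab (x w) ≡ just b →
                    ∀ q → q < p → bit q a ≡ bit q b
        frame     : ∀ v → col (x v) ≡ col (x₀ v) × live (x v) ≡ live (x₀ v)
        lab⇒live  : ∀ {v ℓ} → lab (x v) ≡ just ℓ → live (x v) ≡ true
    open Clustering

    label< : ∀ {x₀ p d x v ℓ} → Clustering x₀ p d x → lab (x v) ≡ just ℓ → ℓ < N
    label< C eq with c , refl , _ ← centred C eq = ident< c

    blueLabel-just : ∀ p l {ℓ} → blueLabel p l ≡ just ℓ → l ≡ just ℓ × bit p ℓ ≡ false
    blueLabel-just p (just m) eq with bit p m in bm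
    blueLabel-just p (just m) refl | false = refl , bm

    blueLabel-blue : ∀ p {l ℓ} → l ≡ just ℓ → bit p ℓ ≡ false → blueLabel p l ≡ just ℓ
    blueLabel-blue p refl bℓ rewrite bℓ = refl

    >>=-just : ∀ {X Y : Set} (m : Maybe X) {f : X → Maybe Y} {y} → (m >>= f) ≡ just y →
               ∃[ x ] (m ≡ just x × f x ≡ just y)
    >>=-just (just x) eq = x , refl , eq

    module _ (p : ℕ) (x : Config) where

      private
        x₁ = ⟦ gather 1 (propose p) ⟧ x
        x₂ = ⟦ gather R decide ⟧ x₁
        x₃ = ⟦ gather R join ⟧ x₂

      open Clusters near N Q p

      propose-red : ∀ {v ℓ} → prop (x₁ v) ≡ just ℓ →
        (∃[ a ] (lab (x v) ≡ just a × bit p a ≡ true)) ×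
        search (λ i → ball 2 x v i >>= blueLabel p ∘ lab ∘ proj₂) N ≡ just ℓ
      propose-red {v} eq with lab (x v)
      ... | just a with bit p a in ba
      ...   | true = (a , refl , ba) , eq

      propose-target : ∀ {v ℓ} → prop (x₁ v) ≡ just ℓ → ∃[ w ] (near v w × lab (x w) ≡ just ℓ × bit p ℓ ≡ false)
      propose-target {v} {ℓ} eq
        with i , found ← search-sound _ N (proj₂ (propose-red eq))
        with e , Vi , blue ← >>=-just (ball 2 x v i) found
        with w , r , _ , refl ← ball-sound 2 x Vi = w , r , blueLabel-just p (lab (x w)) blue

      propose-complete : ∀ {v w a ℓ} → lab (x v) ≡ just a → bit p a ≡ true →
        near v w → lab (x w) ≡ just ℓ → bit p ℓ ≡ false → prop (x₁ v) ≢ nothing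
      propose-complete {v} {w} {a} {ℓ} lv ba r lw bℓ rewrite lv | ba =
        search-complete (λ i → ball 2 x v i >>= blueLabel p ∘ lab ∘ proj₂) (ident< w)
          (trans (cong (_>>= blueLabel p ∘ lab ∘ proj₂) (ball-complete ident-injective 2 x r)) (blueLabel-blue p lw bℓ))

      proposal : ∀ {x₀ q d} → Clustering x₀ q d x → Proposal (labels x) (props x₁)
      proposal C = record
        { proposer = proj₁ ∘ propose-red
        ; target   = λ eq → let w , r , lw , _ = propose-target eq in w , r , lw
        ; blue     = λ eq → proj₂ (proj₂ (proj₂ (propose-target eq)))
        ; small    = λ eq → label< C (proj₁ (proj₂ (proj₂ (propose-target eq))))
        ; complete = propose-complete }

      module _ {x₀ d} (C : Clustering x₀ p d x) (d≤R : 2 + d ≤ suc R) where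

        centre-sees : ∀ {v c} → lab (x v) ≡ just (ident c) → Reach d v c
        centre-sees eq with c′ , ic , r ← centred C eq with refl ← ident-injective ic = r

        proposer-near : ∀ {v c} → prop (x₁ v) ≡ just (ident c) → Reach (2 + d) v c
        proposer-near eq = let w , r , lw , _ = propose-target eq in reach-trans r (centre-sees lw)

        -- Members are within `d` of the centre and applicants within `2 + d`, so the centre's view
        -- contains everyone it has to count.
        decision : ∀ c → acc (x₂ c) ≡ accept (labels x) (props x₁) (ident c)
        decision c = cong₂ (λ s r → s ≤ᵇ Q * r)
          (census-ball ident-injective ident< (suc R) x₁ {c} (λ d′ → lab d′ is ident c)
            (λ v eq → reach-≤ (≤-trans (m≤n+m d 2) d≤R) (reach-sym nbr-sym (centre-sees (is-just eq)))))
          (census-ball ident-injective ident< (suc R) x₁ {c} (λ d′ → prop d′ is ident c)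
            (λ v eq → reach-≤ d≤R (reach-sym nbr-sym (proposer-near (is-just eq)))))

        step-resolve : ∀ {v ℓ} → prop (x₁ v) ≡ just ℓ →
          lab (x₃ v) ≡ (if accept (labels x) (props x₁) ℓ then just ℓ else nothing)
        step-resolve {v} {ℓ} eq
          with c , refl , _ ← centred C (proj₁ (proj₂ (proj₂ (propose-target eq)))) = begin
            joined (prop (x₁ v)) (lab (x v)) V   ≡⟨ cong (λ m → joined m (lab (x v)) V) eq ⟩
            (if maybe (acc ∘ proj₂) false (V (ident c)) then just (ident c) else nothing)
              ≡⟨ cong (λ m → if maybe (acc ∘ proj₂) false m then just (ident c) else nothing)
                   (ball-complete ident-injective (suc R) x₂ (reach-≤ d≤R (proposer-near eq))) ⟩
            (if acc (x₂ c) then just (ident c) else nothing)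
              ≡⟨ cong (λ b → if b then just (ident c) else nothing) (decision c) ⟩
            (if accept (labels x) (props x₁) (ident c) then just (ident c) else nothing) ∎
          where
          open ≡-Reasoning
          V = ball (suc R) x₂ v

        step-correct : Step (labels x) (props x₁) (labels x₃)
        step-correct = record
          { keep    = λ {v} eq → cong (λ m → joined m (lab (x v)) (ball (suc R) x₂ v)) eq
          ; resolve = step-resolve }

        -- Nodes only move to near clusters, whose labels share the bits below p.
        relabelled : ∀ {v ℓ} → lab (x₃ v) ≡ just ℓ →
          (∃[ a ] (lab (x v) ≡ just a × (∀ q → q < p → bit q a ≡ bit q ℓ))) × (∃[ w ] (near v w × lab (x w) ≡ just ℓ))
        relabelled {v} {ℓ} eq with prop (x₁ v) in pv
        ... | nothing = (ℓ , eq , λ _ _ → refl) , (v , stay , eq)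
        ... | just m with accept (labels x) (props x₁) m | step-resolve pv
        ...   | b | e = go b (trans (sym e) (trans (cong (λ k → joined k (lab (x v)) (ball (suc R) x₂ v)) pv) eq))
          where
          go : ∀ b → (if b then just m else nothing) ≡ just ℓ →
            (∃[ a ] (lab (x v) ≡ just a × (∀ q → q < p → bit q a ≡ bit q ℓ))) × (∃[ w ] (near v w × lab (x w) ≡ just ℓ))
          go true refl with (a , lv , _) , _ ← propose-red pv | w , r , lw , _ ← propose-target pv =
            (a , lv , separated C r lv lw) , (w , r , lw)

        step-clustering : Clustering x₀ p (2 + d) x₃
        step-clustering .centred eq with _ , (w , r , lw) ← relabelled eq
          with c , ic , r′ ← centred C lw = c , ic , reach-trans r r′
        step-clustering .separated r lv lw q q<p
          with (a , lv′ , ba) , _ ← relabelled lv | (b , lw′ , bb) , _ ← relabelled lw =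
          trans (sym (ba q q<p)) (trans (separated C r lv′ lw′ q q<p) (bb q q<p))
        step-clustering .frame = frame C
        step-clustering .lab⇒live eq with (a , lv , _) , _ ← relabelled eq = lab⇒live C lv

    liveCount : Config → ℕ
    liveCount x = ∑ (allFin n) (λ v → ind (live (x v)))

    n≤N : length (allFin n) ≤ N
    n≤N = ≤-trans (≤-reflexive (length-tabulate id)) (Fin.injective⇒≤ {f = λ v → fromℕ< (ident< v)}
      (λ eq → ident-injective (trans (sym (Fin.toℕ-fromℕ< (ident< _))) (trans (cong toℕ eq) (Fin.toℕ-fromℕ< (ident< _))))))

    aliveCount≤liveCount : ∀ {x₀ p d x} → Clustering x₀ p d x → aliveCount (labels x) ≤ liveCount x₀
    aliveCount≤liveCount {x₀} {x = x} C = ∑-mono (allFin n) pointwise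
      where
      pointwise : ∀ v → alive (lab (x v)) ≤ ind (live (x₀ v))
      pointwise v with lab (x v) in lv
      ... | nothing = z≤n
      ... | just _ rewrite trans (sym (proj₂ (frame C v))) (lab⇒live C lv) = ≤-refl

    module _ .{{_ : NonZero β}} (x₀ : Config) where

      private
        instance
          Q≢0 : NonZero Q
          Q≢0 = >-nonZero (≤-trans (>-nonZero⁻¹ β) (m≤m+n β β))

      -- Strict because `β` is positive. The exponent `β + β` serves twice: it bounds the doublings
      -- of a cluster and it is the number of epochs.
      crowded : length (allFin n) < 2 ^ (β + β)
      crowded = ≤-<-trans n≤N (^-monoʳ-< 2 (s≤s (s≤s z≤n)) (m<m+n β (>-nonZero⁻¹ β)))

      module Phase (p : ℕ) (p<β : p < β) {x d} (C : Clustering x₀ p d x) (d≤ : d ≤ p * (T′ * 2)) where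
        open Clusters near N Q p

        after : ℕ → Config
        after t = ⟦ loop t (λ _ → step p) ⟧ x

        -- After `p` phases and `t` steps the radius is at most `(p * T′ + t) * 2`, hence at most
        -- `β * (T′ * 2)`. The remaining 2 of `suc R` reaches the applicants.
        in-range : ∀ {t} → t < T′ → 2 + (t * 2 + d) ≤ suc R
        in-range {t} t<T = s≤s (s≤s (≤-trans (+-mono-≤ (*-monoˡ-≤ 2 (<⇒≤ t<T)) d≤) (*-monoˡ-≤ (T′ * 2) p<β)))

        steps : ∀ t → t ≤ T′ → Clustering x₀ p (t * 2 + d) (after t) ×
                Progress t (aliveCount (labels x)) (labels (after t)) (props (⟦ gather 1 (propose p) ⟧ (after t)))
        steps zero    _   = C , progress-start (proposal p x C)
        steps (suc t) t<T with C′ , progress ← steps t (<⇒≤ t<T) =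
          C″ , progress-step (proposal p (after t) C′) (step-correct p (after t) C′ (in-range t<T))
                              (proposal p (after (suc t)) C″) progress
          where C″ = step-clustering p (after t) C′ (in-range t<T)

        private
          C-end = proj₁ (steps T′ ≤-refl)
          progress-end = proj₂ (steps T′ ≤-refl)

        phase-clustering : Clustering x₀ (suc p) (T′ * 2 + d) (after T′)
        phase-clustering .centred   = centred C-end
        phase-clustering .frame     = frame C-end
        phase-clustering .lab⇒live  = lab⇒live C-end
        phase-clustering .separated r lv lw q q<1+p with q ≟ p
        -- `T′` is `Q * (β + β)`, enough steps for `β + β` doublings.
        ... | yes refl = bit-agrees {k = β + β} (proposal p (after T′) C-end) progress-end crowded near-sym r lv lw
        ... | no q≢p   = separated C-end r lv lw q (≤∧≢⇒< (s≤s⁻¹ q<1+p) q≢p)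

        phase-alive : Q * aliveCount (labels x) ≤ Q * aliveCount (labels (after T′)) + aliveCount (labels (after T′))
        phase-alive = alive-kept {k = β + β} (proposal p (after T′) C-end) progress-end crowded

      -- A phase deletes at most `1 / Q` times the number of its survivors, hence at most
      -- `liveCount x₀ / Q` nodes. The inequality sums this over `p` phases and is multiplied
      -- through by `Q`.
      phases-correct : ∀ {x} → Clustering x₀ 0 0 x → aliveCount (labels x) ≡ liveCount x₀ → ∀ p → p ≤ β →
        let y = ⟦ loop p (λ p → loop T′ (λ _ → step p)) ⟧ x in
        Clustering x₀ p (p * (T′ * 2)) y × Q * liveCount x₀ ≤ Q * aliveCount (labels y) + p * liveCount x₀
      phases-correct C start zero    _   = C , ≤-trans (≤-reflexive (cong (Q *_) (sym start))) (m≤m+n _ 0)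
      phases-correct {x} C start (suc p) p<β with C′ , count ← phases-correct C start p (<⇒≤ p<β) =
        phase-clustering , (begin
          Q * L                      ≤⟨ count ⟩
          Q * aliveCount (labels y) + p * L ≤⟨ +-monoˡ-≤ (p * L) phase-alive ⟩
          Q * a′ + a′ + p * L        ≤⟨ +-monoˡ-≤ (p * L) (+-monoʳ-≤ (Q * a′) (aliveCount≤liveCount phase-clustering)) ⟩
          Q * a′ + L + p * L         ≡⟨ +-assoc (Q * a′) L (p * L) ⟩
          Q * a′ + suc p * L         ∎)
        where
        open ≤-Reasoning
        L = liveCount x₀
        y = ⟦ loop p (λ p → loop T′ (λ _ → step p)) ⟧ x
        open Phase p p<β C′ ≤-refl
        a′ = aliveCount (labels (after T′))

    -- Colouring within an epoch

    module _ (Δ : ℕ) (degree≤ : ∀ v → length (nbr v) ≤ Δ) where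

      private k = 2 * Δ ∸ 1

      record Coloured (x : Config) : Set where
        field
          agree    : ∀ {v u} → u ∈ nbr v → col (x v) (ident u) ≡ col (x u) (ident v)
          proper   : ∀ {v u w a} → u ∈ nbr v → w ∈ nbr v → u ≢ w →
                     col (x v) (ident u) ≡ just a → col (x v) (ident w) ≢ just a
          bounded  : ∀ {v u a} → u ∈ nbr v → col (x v) (ident u) ≡ just a → a < k
          finished : ∀ {v u} → live (x v) ≡ false → u ∈ nbr v → col (x v) (ident u) ≢ nothing
      open Coloured

      -- One epoch: `x` is its start, `y` the result of its phases, `z` carries the plans, and `x′`
      -- is its end. By `frame`, the colours visible in `y` are those of `x`.
      module Colouring {x y} (coloured : Coloured x) (C : Clustering x β (β * (T′ * 2)) y) where

        private
          z  = ⟦ gather R design ⟧ y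
          x′ = ⟦ gather R adopt ⟧ z

        same-label : ∀ {v w a b} → near v w → lab (y v) ≡ just a → lab (y w) ≡ just b → a ≡ b
        same-label r lv lw = bits-injective β (label< C lv) (label< C lw) (separated C r lv lw)

        module _ (c : Fin n) where

          private W = ball (suc R) y c
          open Greedy (visibleNbrs W)

          plan-of : ℕ → ℕ → Maybe ℕ
          plan-of = plan (z c)

          visible⁻ : ∀ {i j} → j ∈ visibleNbrs W i → ∃[ u ] ∃[ w ]
            (ident u ≡ i × ident w ≡ j × w ∈ nbr u × (∀ l → visibleCol W i l ≡ col (x u) l))
          visible⁻ {i} j∈ with W i in Wi
          ... | just e with u , _ , iu , refl ← ball-sound (suc R) y {c} Wi
                       with w , w∈ , refl ← ∈-map⁻ ident j∈ =
            u , w , iu , refl , w∈ , λ l → cong (λ f → f l) (proj₁ (frame C u))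

          visible⁺ : ∀ {u w} → Reach (suc R) c u → w ∈ nbr u → ident w ∈ visibleNbrs W (ident u)
          visible⁺ {u} {w} r w∈ = subst (λ m → ident w ∈ maybe proj₁ [] m)
            (sym (ball-complete ident-injective (suc R) y r)) (∈-map⁺ ident w∈)

          visible-col : ∀ {u} → Reach (suc R) c u → ∀ l → visibleCol W (ident u) l ≡ col (x u) l
          visible-col {u} r l = trans
            (cong (maybe (λ e → col (proj₂ e) l) nothing) (ball-complete ident-injective (suc R) y r))
            (cong (λ f → f l) (proj₁ (frame C u)))

          visible-degree : ∀ i → length (visibleNbrs W i) ≤ Δ
          visible-degree i with W i in Wi
          ... | nothing = z≤n
          ... | just e with u , _ , _ , refl ← ball-sound (suc R) y {c} Wi =
            ≤-trans (≤-reflexive (length-map ident (nbr u))) (degree≤ u)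

          visible-good : Good k (visibleCol W)
          visible-good .Good.symmetric j∈ i∈
            with u , w , refl , refl , w∈ , cu ← visible⁻ j∈
            with w′ , u′ , iw , iu , _ , cw ← visible⁻ i∈
            with refl ← ident-injective iw =
            trans (cu _) (trans (agree coloured w∈) (sym (cw _)))
          visible-good .Good.proper j∈ j′∈ j≢j′ cj cj′
            with u , w , refl , refl , w∈ , cu ← visible⁻ j∈
            with u′ , w′ , iu , refl , w′∈ , cu′ ← visible⁻ j′∈
            with refl ← ident-injective iu =
            proper coloured w∈ w′∈ (j≢j′ ∘ cong ident) (trans (sym (cu _)) cj) (trans (sym (cu _)) cj′)
          visible-good .Good.bounded j∈ cj
            with u , w , refl , refl , w∈ , cu ← visible⁻ j∈ = bounded coloured w∈ (trans (sym (cu _)) cj)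

          plan-good : Good k plan-of
          plan-good = greedy-good visible-degree N visible-good

          plan-extends : ∀ {v u a} → Reach (suc R) c v → col (x v) (ident u) ≡ just a →
            plan-of (ident v) (ident u) ≡ just a
          plan-extends r cvu = greedy-extends visible-degree N visible-good (trans (visible-col r _) cvu)

          plan-colours : ∀ {v u} → Reach (suc R) c v → Reach (suc R) c u → u ∈ nbr v →
            plan-of (ident v) (ident u) ≢ nothing
          plan-colours r r′ u∈ = greedy-colours visible-degree N visible-good (ident< _) (ident< _)
            (visible⁺ r u∈) (visible⁺ r′ (nbr-sym u∈))

        own : Fin n → Fin n → Maybe ℕ
        own v u = lab (y v) <∣> lab (y u)

        owner-own : ∀ {v u} → u ∈ nbr v → owner (lab (y v)) (ident u) (ball (suc R) z v) ≡ own v u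
        owner-own {v} {u} u∈ = cong (λ m → lab (y v) <∣> (m >>= lab ∘ proj₂))
          (ball-complete ident-injective (suc R) z (hop u∈ stay))

        own-member : ∀ {v u ℓ} → u ∈ nbr v → own v u ≡ just ℓ →
          ∃[ t ] (lab (y t) ≡ just ℓ × Reach 1 v t × Reach 1 u t)
        own-member {v} {u} u∈ eq with lab (y v) in lv
        own-member {v} {u} u∈ refl | just _  = v , lv , stay , hop (nbr-sym u∈) stay
        own-member {v} {u} u∈ eq   | nothing = u , eq , hop u∈ stay , stay

        -- Each owner has a labelled endpoint within one hop of `v`. These two nodes are at distance
        -- at most 2, which is the reason for separating clusters at that distance.
        own-unique : ∀ {v u w ℓ m} → u ∈ nbr v → w ∈ nbr v → own v u ≡ just ℓ → own v w ≡ just m → ℓ ≡ m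
        own-unique u∈ w∈ ou ow
          with t , lt , vt , _ ← own-member u∈ ou | s , ls , vs , _ ← own-member w∈ ow =
          same-label (reach-trans (reach-sym nbr-sym vt) vs) lt ls

        own-sym : ∀ {v u} → u ∈ nbr v → own v u ≡ own u v
        own-sym {v} {u} u∈ with lab (y v) in lv | lab (y u) in lu
        ... | just _  | just _  = cong just (same-label (hop u∈ stay) lv lu)
        ... | just _  | nothing = refl
        ... | nothing | just _  = refl
        ... | nothing | nothing = refl

        adopt-old : ∀ {v u} → u ∈ nbr v → own v u ≡ nothing → col (x′ v) (ident u) ≡ col (x v) (ident u)
        adopt-old {v} {u} u∈ eq =
          trans (cong (λ o → adopted o (col (y v) (ident u)) (ident v) (ident u) (ball (suc R) z v))
                  (trans (owner-own u∈) eq))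
                (cong (λ f → f (ident u)) (proj₁ (frame C v)))

        adopt-new : ∀ {v u ℓ} → u ∈ nbr v → own v u ≡ just ℓ → ∃[ c ] (ident c ≡ ℓ ×
          Reach (suc R) c v × Reach (suc R) c u × col (x′ v) (ident u) ≡ plan-of c (ident v) (ident u))
        adopt-new {v} {u} u∈ eq with t , lt , vt , ut ← own-member u∈ eq
          with c , refl , tc ← centred C lt =
          c , refl , reach-sym nbr-sym vc , reach-sym nbr-sym (reach-≤ (n≤1+n R) (reach-trans ut tc)) ,
          trans (cong (λ o → adopted o (col (y v) (ident u)) (ident v) (ident u) (ball (suc R) z v))
                  (trans (owner-own u∈) eq))
                (cong (maybe (λ e → plan (proj₂ e) (ident v) (ident u)) nothing)
                  (ball-complete ident-injective (suc R) z vc))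
          where vc = reach-≤ (n≤1+n R) (reach-trans vt tc)

        plan-proper : ∀ c {v u w a} → Reach (suc R) c v → u ∈ nbr v → w ∈ nbr v → u ≢ w →
          plan-of c (ident v) (ident u) ≡ just a → plan-of c (ident v) (ident w) ≢ just a
        plan-proper c r u∈ w∈ u≢w = Greedy.Good.proper (plan-good c)
          (visible⁺ c r u∈) (visible⁺ c r w∈) (u≢w ∘ ident-injective)

        -- Only labelled nodes die in an epoch, and an unowned edge has no labelled endpoint.
        unowned-dead : ∀ {v u} → own v u ≡ nothing → live (x′ v) ≡ false → live (x v) ≡ false
        unowned-dead {v} ou dead with lab (y v)
        ... | nothing = trans (sym (proj₂ (frame C v))) dead

        coloured′ : Coloured x′
        coloured′ .agree {v} {u} u∈ with own v u in ou
        ... | nothing = trans (adopt-old u∈ ou) (trans (agree coloured u∈)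
                          (sym (adopt-old (nbr-sym u∈) (trans (sym (own-sym u∈)) ou))))
        ... | just ℓ with c , ic , r , r′ , new ← adopt-new u∈ ou
                     with c′ , ic′ , _ , _ , new′ ← adopt-new (nbr-sym u∈) (trans (sym (own-sym u∈)) ou)
                     with refl ← ident-injective (trans ic (sym ic′)) =
          trans new (trans (Greedy.Good.symmetric (plan-good c) (visible⁺ c r u∈) (visible⁺ c r′ (nbr-sym u∈))) (sym new′))
        coloured′ .proper {v} {u} {w} u∈ w∈ u≢w cu cw with own v u in ou | own v w in ow
        ... | nothing | nothing =
          proper coloured u∈ w∈ u≢w (trans (sym (adopt-old u∈ ou)) cu) (trans (sym (adopt-old w∈ ow)) cw)
        -- The unowned edge keeps its old colour, which the plan of the other edge's owner also
        -- assigns to it, so both colours can be compared within that one plan.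
        ... | just _ | nothing with c , _ , r , _ , new ← adopt-new u∈ ou =
          plan-proper c r u∈ w∈ u≢w (trans (sym new) cu) (plan-extends c r (trans (sym (adopt-old w∈ ow)) cw))
        ... | nothing | just _ with c , _ , r , _ , new ← adopt-new w∈ ow =
          plan-proper c r u∈ w∈ u≢w (plan-extends c r (trans (sym (adopt-old u∈ ou)) cu)) (trans (sym new) cw)
        -- Owned edges at a common endpoint have the same owner, so again a single plan is involved.
        ... | just _ | just _ with c , ic , r , _ , new ← adopt-new u∈ ou
                              with c′ , ic′ , _ , _ , new′ ← adopt-new w∈ ow
                              with refl ← ident-injective (trans ic (trans (own-unique u∈ w∈ ou ow) (sym ic′))) =
          plan-proper c r u∈ w∈ u≢w (trans (sym new) cu) (trans (sym new′) cw)
        coloured′ .bounded {v} {u} u∈ cu with own v u in ou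
        ... | nothing = bounded coloured u∈ (trans (sym (adopt-old u∈ ou)) cu)
        ... | just _ with c , _ , r , _ , new ← adopt-new u∈ ou =
          Greedy.Good.bounded (plan-good c) (visible⁺ c r u∈) (trans (sym new) cu)
        coloured′ .finished {v} {u} dead u∈ cu with own v u in ou
        ... | just _ with c , _ , r , r′ , new ← adopt-new u∈ ou =
          plan-colours c r r′ u∈ (trans (sym new) cu)
        ... | nothing = finished coloured (unowned-dead {v} {u} ou dead) u∈ (trans (sym (adopt-old u∈ ou)) cu)

        live-lost : liveCount x′ + aliveCount (labels y) ≤ liveCount x
        live-lost = ≤-trans (≤-reflexive (sym (∑-+ (allFin n) _ _))) (∑-mono (allFin n) pointwise)
          where
          pointwise : ∀ v → ind (live (x′ v)) + alive (lab (y v)) ≤ ind (live (x v))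
          pointwise v with lab (y v) in lv
          ... | nothing = ≤-reflexive (trans (+-identityʳ _) (cong ind (proj₂ (frame C v))))
          ... | just _ rewrite trans (sym (proj₂ (frame C v))) (lab⇒live C lv) = ≤-refl

      reset-clustering : ∀ x → Clustering x 0 0 (⟦ gather 0 reset ⟧ x)
      reset-clustering x .centred {v} eq with live (x v)
      reset-clustering x .centred {v} refl | true = v , refl , stay
      reset-clustering x .separated _ _ _ q ()
      reset-clustering x .frame v = refl , refl
      reset-clustering x .lab⇒live {v} eq with live (x v)
      ... | true = refl

      reset-alive : ∀ x → aliveCount (labels (⟦ gather 0 reset ⟧ x)) ≡ liveCount x
      reset-alive x = ∑-cong (allFin n) pointwise
        where
        pointwise : ∀ v → alive (lab (⟦ gather 0 reset ⟧ x v)) ≡ ind (live (x v))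
        pointwise v with live (x v)
        ... | true  = refl
        ... | false = refl

      module _ .{{_ : NonZero β}} where

        epoch-correct : ∀ {x} → Coloured x →
          Coloured (⟦ epoch ⟧ x) × 2 * liveCount (⟦ epoch ⟧ x) ≤ liveCount x
        epoch-correct {x} coloured
          with C , count ← phases-correct x (reset-clustering x) (reset-alive x) β ≤-refl =
          coloured′ , halved (liveCount (⟦ epoch ⟧ x)) (aliveCount (labels y)) (liveCount x) count live-lost
          where
          y = ⟦ phases ⟧ (⟦ gather 0 reset ⟧ x)
          open Colouring coloured C
          halved : ∀ l a L → Q * L ≤ Q * a + β * L → l + a ≤ L → 2 * l ≤ L
          halved l a L count lost = +-cancelʳ-≤ (2 * a) (2 * l) L (begin
            2 * l + 2 * a   ≡⟨ *-distribˡ-+ 2 l a ⟨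
            2 * (l + a)     ≤⟨ *-monoʳ-≤ 2 lost ⟩
            L + (L + 0)     ≡⟨ cong (L +_) (+-identityʳ L) ⟩
            L + L           ≤⟨ +-monoʳ-≤ L half-alive ⟩
            L + 2 * a       ∎)
            where
            open ≤-Reasoning
            open +-*-Solver
            -- With `Q = β + β`, the `β` phases lose at most `β / Q`, that is, half of `L`.
            half-alive : L ≤ 2 * a
            half-alive = *-cancelˡ-≤ β (+-cancelʳ-≤ (β * L) (β * L) (β * (2 * a)) (begin
              β * L + β * L         ≡⟨ *-distribʳ-+ L β β ⟨
              Q * L                 ≤⟨ count ⟩
              Q * a + β * L         ≡⟨ cong (_+ β * L) (solve 2 (λ b a → (b :+ b) :* a := b :* (con 2 :* a)) refl β a) ⟩
              β * (2 * a) + β * L   ∎))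

        epochs-correct : ∀ {x} → Coloured x → ∀ m → let y = ⟦ loop m (λ _ → epoch) ⟧ x in
          Coloured y × 2 ^ m * liveCount y ≤ liveCount x
        epochs-correct coloured zero = coloured , ≤-reflexive (*-identityˡ _)
        epochs-correct {x} coloured (suc m) with coloured₁ , count₁ ← epochs-correct coloured m
          with coloured₂ , count₂ ← epoch-correct coloured₁ = coloured₂ , (begin
            2 * 2 ^ m * l₂     ≡⟨ cong (_* l₂) (*-comm 2 (2 ^ m)) ⟩
            2 ^ m * 2 * l₂     ≡⟨ *-assoc (2 ^ m) 2 l₂ ⟩
            2 ^ m * (2 * l₂)   ≤⟨ *-monoʳ-≤ (2 ^ m) count₂ ⟩
            2 ^ m * _          ≤⟨ count₁ ⟩
            liveCount x        ∎)
          where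
          open ≤-Reasoning
          l₂ = liveCount (⟦ loop (suc m) (λ _ → epoch) ⟧ x)

        program-correct : ∀ {x} → Coloured x →
          Coloured (⟦ program ⟧ x) × (∀ v → live (⟦ program ⟧ x v) ≡ false)
        program-correct {x} coloured = subst (λ P → Coloured (⟦ P ⟧ x) × (∀ v → live (⟦ P ⟧ x v) ≡ false))
          (sym program≡) (proj₁ (epochs-correct coloured (β + β)) , dead)
          where
          y = ⟦ loop (β + β) (λ _ → epoch) ⟧ x
          dead : ∀ v → live (y v) ≡ false
          dead v with live (y v) in lv
          ... | false = refl
          -- The live nodes have been halved `β + β` times, so one survivor would force at least
          -- `2 ^ (β + β)` nodes at the start.
          ... | true  = contradiction (begin
            2 ^ (β + β)                 ≡⟨ *-identityʳ _ ⟨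
            2 ^ (β + β) * 1             ≤⟨ *-monoʳ-≤ (2 ^ (β + β)) (subst (λ b → ind b ≤ liveCount y) lv
                                             (term≤∑ (λ v → ind (live (y v))) (∈-allFin v))) ⟩
            2 ^ (β + β) * liveCount y   ≤⟨ proj₂ (epochs-correct coloured (β + β)) ⟩
            liveCount x                 ≤⟨ ∑-≤-length (allFin n) (λ v → ind≤1 (live (x v))) ⟩
            length (allFin n)           ∎) (<⇒≱ (crowded x))
            where open ≤-Reasoning

-- Running time

infix 4 _≼_

-- `f β = O(β ^ e)` with an explicit constant. Restricting to `β ≥ 1` allows exponents to be raised.
record _≼_ (f : ℕ → ℕ) (e : ℕ) : Set where
  constructor bound
  field
    constant : ℕ
    dominate : ∀ β → 1 ≤ β → f β ≤ constant * β ^ e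

≼-const : ∀ k → (λ _ → k) ≼ 0
≼-const k = bound k λ _ _ → ≤-reflexive (sym (*-identityʳ k))

≼-id : (λ β → β) ≼ 1
≼-id = bound 1 λ β _ → ≤-reflexive (sym (trans (*-identityˡ _) (^-identityʳ β)))

≼-+ : ∀ {f g e} → f ≼ e → g ≼ e → (λ β → f β + g β) ≼ e
≼-+ {e = e} (bound K f≤) (bound K′ g≤) = bound (K + K′) λ β 1≤β →
  ≤-trans (+-mono-≤ (f≤ β 1≤β) (g≤ β 1≤β)) (≤-reflexive (sym (*-distribʳ-+ (β ^ e) K K′)))

≼-* : ∀ {f g d e} → f ≼ d → g ≼ e → (λ β → f β * g β) ≼ d + e
≼-* {f} {g} {d} {e} (bound K f≤) (bound K′ g≤) = bound (K * K′) λ β 1≤β → begin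
  f β * g β                       ≤⟨ *-mono-≤ (f≤ β 1≤β) (g≤ β 1≤β) ⟩
  K * β ^ d * (K′ * β ^ e)
    ≡⟨ solve 4 (λ k k′ x y → k :* x :* (k′ :* y) := k :* k′ :* (x :* y)) refl K K′ (β ^ d) (β ^ e) ⟩
  K * K′ * (β ^ d * β ^ e)        ≡⟨ cong (K * K′ *_) (^-distribˡ-+-* β d e) ⟨
  K * K′ * β ^ (d + e)            ∎
  where
  open ≤-Reasoning
  open +-*-Solver

≼-raise : ∀ {f d e} → d ≤ e → f ≼ d → f ≼ e
≼-raise d≤e (bound K f≤) = bound K λ β 1≤β →
  ≤-trans (f≤ β 1≤β) (*-monoʳ-≤ K (^-monoʳ-≤ β {{>-nonZero 1≤β}} d≤e))

≼-trans : ∀ {f g e} → (∀ β → f β ≤ g β) → g ≼ e → f ≼ e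
≼-trans f≤g (bound K g≤) = bound K λ β 1≤β → ≤-trans (f≤g β) (g≤ β 1≤β)

-- The exponent is `1 + 1 + 2 + 3`: `2 * β` epochs, `β` phases in each, `4 * β ^ 2` steps per phase,
-- and a number of rounds per step proportional to the radius, which is of order `β ^ 3`.
program-cost : (λ β → cost (Parameters.program β)) ≼ 7
program-cost = ≼-trans
  (λ β → ≤-trans (≤-reflexive (cong cost (program≡ β))) (cost-loop (β + β) (λ _ → epoch β)
           (λ _ → ≤-trans (≤-reflexive (epoch-cost β))
           (s≤s (+-monoˡ-≤ _ (cost-loop β _ (λ p → cost-loop (T′ β) _ (λ _ → ≤-reflexive (step-cost β p)))))))))
  (≼-* 2β (≼-+ (≼-raise z≤n (≼-const 1)) (≼-+ (≼-* ≼-id (≼-* T′≼2 step≼3)) (≼-raise (m≤m+n 3 3) (≼-+ radius≼3 radius≼3)))))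
  where
  open Parameters
  2β : (λ β → β + β) ≼ 1
  2β = ≼-+ ≼-id ≼-id
  T′≼2 : T′ ≼ 2
  T′≼2 = ≼-* 2β 2β
  radius≼3 : (λ β → suc (R β)) ≼ 3
  radius≼3 = ≼-+ (≼-raise z≤n (≼-const 2)) (≼-* ≼-id (≼-* T′≼2 (≼-const 2)))
  step≼3 : (λ β → 2 + (suc (R β) + suc (R β))) ≼ 3
  step≼3 = ≼-+ (≼-raise z≤n (≼-const 2)) (≼-+ radius≼3 radius≼3)
  two-gathers : ∀ β f g → cost (gather (R β) f ⨾ gather (R β) g) ≡ suc (R β) + suc (R β)
  two-gathers β f g = trans (cost-⨾ (gather (R β) f) (gather (R β) g)) (cong₂ _+_ (cost-gather (R β) f) (cost-gather (R β) g))
  step-cost : ∀ β p → cost (step β p) ≡ 2 + (suc (R β) + suc (R β))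
  step-cost β p = cong (2 +_) (two-gathers β (decide β) (join β))
  epoch-cost : ∀ β → cost (epoch β) ≡ 1 + (cost (phases β) + (suc (R β) + suc (R β)))
  epoch-cost β = cong suc (trans (cost-⨾ (phases β) (gather (R β) (design β) ⨾ gather (R β) (adopt β)))
    (cong (cost (phases β) +_) (two-gathers β (design β) (adopt β))))

-- The successor keeps `β` positive also when `b` or `⌈log₂ n ⌉` is 0.
idBits : ℕ → ℕ → ℕ
idBits b n = suc (b * ⌈log₂ n ⌉)

idBits-polylog : ∀ b n c → idBits b n ^ c ≤ suc b ^ c * (1 ⊔ ⌈log₂ n ⌉ ^ c)
idBits-polylog b n c = begin
  suc (b * L) ^ c               ≤⟨ ^-monoˡ-≤ c (+-mono-≤ (m≤m⊔n 1 L) (*-monoʳ-≤ b (m≤n⊔m 1 L))) ⟩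
  (suc b * (1 ⊔ L)) ^ c         ≡⟨ *-^ (suc b) (1 ⊔ L) c ⟩
  suc b ^ c * (1 ⊔ L) ^ c       ≤⟨ *-monoʳ-≤ (suc b ^ c) (⊔-^ L) ⟩
  suc b ^ c * (1 ⊔ L ^ c)       ∎
  where
  open ≤-Reasoning
  L = ⌈log₂ n ⌉
  ⊔-^ : ∀ l → (1 ⊔ l) ^ c ≤ 1 ⊔ l ^ c
  ⊔-^ zero    = ≤-trans (≤-reflexive (^-zeroˡ c)) (m≤m⊔n 1 (0 ^ c))
  ⊔-^ (suc l) = m≤n⊔m 1 (suc l ^ c)

-- The algorithm and its correctness on a graph

colouring : ℕ → Algorithm
colouring b = algorithm initialNode (λ n _ → Parameters.program (idBits b n)) (λ d i → fromMaybe 0 (col d i))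

module Correctness {b n : ℕ} (G : Graph n) (I : Identifiers b n) where
  open Graph G
  open Identifiers I
  open Simulation initialNode (λ n _ → Parameters.program (idBits b n)) (λ d i → fromMaybe 0 (col d i)) G I
    using (colour-run)
  open Execution (colouring b) G I using (neighbours; colour)

  private β = idBits b n

  neighbours⁺ : ∀ {v u} → Adj v u → u ∈ neighbours v
  neighbours⁺ {v} {u} vu = ∈-resp-↭ (↭-sym (Sort.sort-↭ _ (filter (adj? v) (allFin n))))
    (∈-filter⁺ (adj? v) (∈-allFin u) vu)

  neighbours⁻ : ∀ {v u} → u ∈ neighbours v → Adj v u
  neighbours⁻ {v} u∈ = proj₂ (∈-filter⁻ (adj? v) {xs = allFin n}
    (∈-resp-↭ (Sort.sort-↭ _ (filter (adj? v) (allFin n))) u∈))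

  neighbours-sym : ∀ {u v} → u ∈ neighbours v → v ∈ neighbours u
  neighbours-sym = neighbours⁺ ∘ symm ∘ neighbours⁻

  neighbours≤ : ∀ v → length (neighbours v) ≤ maxDegree
  neighbours≤ v = ≤-trans (≤-reflexive (↭-length (Sort.sort-↭ _ (filter (adj? v) (allFin n)))))
    (All.lookup (xs≤max 0 (map degree (allFin n))) (∈-map⁺ degree (∈-allFin v)))

  ident<2^β : ∀ v → ident v < 2 ^ β
  ident<2^β v = <-≤-trans (short v) (^-monoʳ-≤ 2 (n≤1+n (b * ⌈log₂ n ⌉)))

  open Local.Semantics Node ident neighbours using (⟦_⟧)
  open Parameters.Analysis β ident neighbours distinct ident<2^β neighbours-sym

  module _ {x} (coloured : Coloured maxDegree neighbours≤ x) (done : ∀ v → live (x v) ≡ false)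
           {edgeColour : Fin n → Fin n → ℕ} (colour≡ : ∀ v u → edgeColour v u ≡ fromMaybe 0 (col (x v) (ident u))) where
    open Coloured coloured

    coloured-edge : ∀ {v u} → Adj v u → ∃[ a ] (col (x v) (ident u) ≡ just a × edgeColour v u ≡ a)
    coloured-edge {v} {u} vu with col (x v) (ident u) in eq
    ... | nothing = contradiction eq (finished (done v) (neighbours⁺ vu))
    ... | just a  = a , refl , trans (colour≡ v u) (cong (fromMaybe 0) eq)

    proper-colouring : IsProperEdgeColouring G (2 * maxDegree ∸ 1) edgeColour
    proper-colouring = record
      { palette = λ vu → let a , ca , eq = coloured-edge vu in
          subst (_< 2 * maxDegree ∸ 1) (sym eq) (bounded (neighbours⁺ vu) ca)
      ; agree = λ {v} {u} vu → trans (colour≡ v u)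
          (trans (cong (fromMaybe 0) (agree (neighbours⁺ vu))) (sym (colour≡ u v)))
      ; proper = λ vu vw u≢w same →
          let a , ca , eq = coloured-edge vu ; a′ , ca′ , eq′ = coloured-edge vw in
          proper (neighbours⁺ vu) (neighbours⁺ vw) u≢w ca
            (trans ca′ (cong just (trans (sym eq′) (trans (sym same) eq)))) }

  initially-coloured : Coloured maxDegree neighbours≤ (λ _ → initialNode)
  initially-coloured = record
    { agree = λ _ → refl ; proper = λ _ _ _ () ; bounded = λ _ () ; finished = λ () }

  properly-coloured : IsProperEdgeColouring G (2 * maxDegree ∸ 1) colour
  properly-coloured = let coloured , done = program-correct maxDegree neighbours≤ initially-coloured in
    proper-colouring coloured done colour-run

no-excess : ∀ p → p ℚ.≤ p ℚ.* (1ℚ ℚ.+ 0ℚ)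
no-excess p = ℚ.≤-reflexive (sym (trans (cong (p ℚ.*_) (ℚ.+-identityʳ 1ℚ)) (ℚ.*-identityʳ p)))

theorem1p1 : ∃[ c ] (0 < c ×
    ∃[ δ ] ((∀ (n : ℕ) → 0ℚ ℚ.≤ δ n) × TendsToZero δ ×
    (∀ (b : ℕ) → ∃[ A ] ComputesColouring b c δ A)))
theorem1p1 = 7 , s≤s z≤n , (λ _ → 0ℚ) , (λ _ → ℚ.≤-refl) , (λ ε 0<ε → 0 , λ _ _ → 0<ε) ,
  λ b → let bound K cost≤ = program-cost in
    -- The factor `suc b ^ 7` converts the seventh power of `idBits b n` into that of the logarithm.
    colouring b , K * suc b ^ 7 , λ n G I _ →
      ≤-trans (cost≤ (idBits b n) (s≤s z≤n))
        (≤-trans (*-monoʳ-≤ K (idBits-polylog b n 7)) (≤-reflexive (sym (*-assoc K (suc b ^ 7) _)))) ,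
      _ , no-excess (ℤ.+ (2 * Graph.maxDegree G ∸ 1) ℚ./ 1) ,
      Correctness.properly-coloured G I
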